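{- Let $q=p^n$ where $p$ is a prime, let $\theta$ be a primitive element of $GF(q)$, and let $k\geq 3$ and $r\geq 1$ be integers with $q-1=kr$. Let $B:=\langle\theta^r\rangle\cup\{0\}\subseteq GF(q)$. Then the orbit of $B$ under the action of $PGL(2,q)$ on the $(k+1)$-subsets of $X=GF(q)\cup\{\infty\}$ is (the block set of) a simple $3$-$(q+1,k+1,\lambda)$ design on $X$, where $$\lambda=\begin{cases}2 & \text{if } k=3,\\ (k+1)(k-1) & \text{if } k\geq 4 \text{ and } k+1 \text{ does not divide } q,\\ k-1 & \text{if } k\geq 4 \text{ and } k+1 \text{ divides } q.\end{cases}$$
   Context: $PGL(2,q)$ is the group of maps $x\mapsto \frac{ax+b}{cx+d}$ on $X=GF(q)\cup\{\infty\}$ with $a,b,c,d\in GF(q)$, $ad-bc\neq 0$, with the usual conventions for $\infty$. $\langle\theta^r\rangle$ is the multiplicative subgroup of $GF(q)^*$ generated by $\theta^r$ (of order $k$). A $3$-$(v,k',\lambda)$ design is a pair $(X,\mathcal{B})$ with $|X|=v$ and $\mathcal{B}$ a collection of $k'$-subsets (blocks) of $X$ such that every $3$-subset of $X$ lies in exactly $\lambda$ blocks; it is simple if $\mathcal{B}$ has no repeated blocks. -}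

module Defs where

open import Data.Nat using (ℕ; zero; suc; _∸_) renaming (_*_ to _*ℕ_)
open import Data.Nat.Divisibility using (_∣?_)
open import Data.Fin using (Fin; zero; suc) renaming (_≟_ to _≟F_)
open import Data.Fin.Subset using (Subset; _∈_)
open import Data.Product using (Σ; ∃; _×_; _,_)
open import Data.Sum using (_⊎_)
open import Data.Empty using (⊥)
open import Relation.Nullary using (¬_; yes; no)
open import Relation.Binary.PropositionalEquality using (_≡_; _≢_)
open import Function.Bundles using (_⇔_)
import Algebra.Structures

-- A finite field with exactly q elements, realised on the carrier Fin q
-- (every finite field of order q is isomorphic to one of this form).
-- Equality is propositional equality on Fin q; _⁻¹ is a multiplicative
-- inverse on nonzero elements (its value at 0# is irrelevant).
record FiniteFieldOn (q : ℕ) : Set where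
  infixl 6 _+_
  infixl 7 _*_
  field
    _+_ _*_ : Fin q → Fin q → Fin q
    -_      : Fin q → Fin q
    0# 1#   : Fin q
    _⁻¹     : Fin q → Fin q
    isCommutativeRing : Algebra.Structures.IsCommutativeRing {A = Fin q} _≡_ _+_ _*_ -_ 0# 1#
    0≢1     : 0# ≢ 1#
    inverse : ∀ x → x ≢ 0# → x * (x ⁻¹) ≡ 1#

  _^_ : Fin q → ℕ → Fin q
  x ^ zero  = 1#
  x ^ suc i = x * (x ^ i)

  IsPrimitive : Fin q → Set
  IsPrimitive θ = (θ ≢ 0#) × (∀ x → x ≢ 0# → ∃ λ i → θ ^ i ≡ x)

  -- X = GF(q) ∪ {∞} is encoded as Fin (suc q):  zero = ∞,  suc x = x ∈ GF(q).
  -- Action of the PGL(2,q) element  x ↦ (a x + b)/(c x + d)  on X,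
  -- with the usual conventions for ∞.
  act : (a b c d : Fin q) → Fin (suc q) → Fin (suc q)
  act a b c d zero with c ≟F 0#
  ... | yes _ = zero
  ... | no  _ = suc (a * (c ⁻¹))
  act a b c d (suc x) with (c * x + d) ≟F 0#
  ... | yes _ = zero
  ... | no  _ = suc ((a * x + b) * ((c * x + d) ⁻¹))

  InB : (θ : Fin q) (r : ℕ) → Fin (suc q) → Set
  InB θ r zero    = ⊥
  InB θ r (suc x) = (x ≡ 0#) ⊎ (∃ λ i → x ≡ (θ ^ r) ^ i)

  IsBlock : (θ : Fin q) (r : ℕ) → Subset (suc q) → Set
  IsBlock θ r S =
    Σ (Fin q) λ a → Σ (Fin q) λ b → Σ (Fin q) λ c → Σ (Fin q) λ d →
      ((a * d + - (b * c)) ≢ 0#) ×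
      (∀ y → (y ∈ S) ⇔ (∃ λ x → InB θ r x × act a b c d x ≡ y))

lam : (q k : ℕ) → ℕ
lam q k with k Data.Nat.≟ 3
... | yes _ = 2
... | no  _ with suc k ∣? q
...   | yes _ = k ∸ 1
...   | no  _ = suc k *ℕ (k ∸ 1)

{-# OPTIONS --safe #-}

-- PGL(2,q) is sharply 3-transitive on X, so the blocks through a 3-subset {t₁,t₂,t₃} correspond to the
-- orbits of the stabiliser of B on ordered triples of distinct elements of B. A stabilising map fixing 0
-- is x ↦ u x: it has the form a x/(c x + d), so (c x + d)ᵏ is constant on the k-th roots of unity, and
-- comparing coefficients gives c = 0. Hence there are (k + 1)(k − 1) orbits if the stabiliser fixes 0, and
-- k − 1 orbits if some stabilising map sends 1 to 0, since then the stabiliser is transitive on ordered pairs.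
-- For k = 3 such a map is (1 − x)/(1 + 2x); if k + 1 divides q, then B is the set of fixed points of the
-- additive map x ↦ xᵏ⁺¹ and x − 1 is such a map. Conversely, a map exchanging 0 and 1 is (1 − x)/(1 + c x),
-- and (1 + c x)ᵏ − (1 − x)ᵏ is then a multiple of x + x² + ⋯ + xᵏ. For k ≥ 4 the first four coefficients
-- force c = 0, so B is closed under subtraction and Lagrange's theorem gives k + 1 ∣ q.
module Submission where

open import Defs
open import Level using (0ℓ)
open import Algebra.Bundles using (CommutativeRing)
open import Algebra.Solver.Ring.AlmostCommutativeRing using (fromCommutativeRing; _-Raw-AlmostCommutative⟶_; Induced-equivalence)
import Algebra.Solver.Ring
import Algebra.Properties.Ring
import Algebra.Properties.Semiring.Mult.TCOptimised
import Algebra.Properties.CommutativeMonoid.Sum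
open import Data.Empty using (⊥; ⊥-elim)
open import Data.Fin using (Fin; zero; suc; _≟_; toℕ; fromℕ<; punchIn; punchOut; remQuot; combine)
open import Data.Fin.Permutation using (Permutation; permutation)
import Data.Fin.Properties as Fin
open import Data.Fin.Subset using (Subset; ∣_∣; _∈_; _∉_; _⊆_; ⊤; inside; outside; Nonempty) renaming (_-_ to _∖_)
open import Data.Fin.Subset.Properties using (x∈p∧x≢y⇒x∈p-y; p─q⊆p; p─⊥≡p; ∣⊤∣≡n; ∈⊤; ∣p∣≤n; ⊆-antisym)
open import Data.Integer as ℤ using (ℤ; -[1+_]) renaming (+_ to pos)
import Data.Integer.Properties as ℤ
open import Data.List as List using (List; length)
open import Data.List.Membership.Propositional using () renaming (_∈_ to _∈L_)
open import Data.List.Membership.Propositional.Properties using (∈-tabulate⁺; ∈-tabulate⁻)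
open import Data.List.Properties using (length-tabulate)
open import Data.List.Relation.Unary.Unique.Propositional using (Unique)
open import Data.List.Relation.Unary.Unique.Propositional.Properties using (tabulate⁺)
open import Data.Maybe using (just; nothing)
open import Data.Nat as ℕ using (ℕ; zero; suc)
open import Data.Nat.Combinatorics using (_C_; nCk+nC[k+1]≡[n+1]C[k+1]; nC1≡n; k>n⇒nCk≡0; nCn≡1)
open import Data.Nat.Coprimality using (Coprime; coprime-divisor)
open import Data.Nat.Divisibility using (_∣_; _∣?_; divides; _∣0; ∣⇒≤; ∣1⇒≡1; ∣-refl; ∣m∣n⇒∣m+n; m%n≡0⇒n∣m; *-cancelˡ-∣; *-cancelʳ-∣)
open import Data.Nat.DivMod using (_%_; _/_; m≡m%n+[m/n]*n; m%n<n)
open import Data.Nat.Primality using (Prime; ¬prime[0]; euclidsLemma; prime⇒nonZero; prime⇒irreducible)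
import Data.Nat.Properties as ℕ
open import Data.Nat.Solver using (module +-*-Solver)
open import Data.Product using (∃; _×_; _,_; proj₁; proj₂; uncurry)
open import Data.Sum using (_⊎_; inj₁; inj₂)
open import Data.Vec as Vec using (_∷_; here; there)
open import Data.Vec.Properties using (lookup∘tabulate; []=⇒lookup; lookup⇒[]=)
open import Function using (_∘_)
open import Function.Bundles using (_⇔_; mk⇔; Equivalence)
open import Function.Definitions using (Injective)
open import Relation.Binary using (tri<; tri≈; tri>)
open import Relation.Binary.Definitions using (WeaklyDecidable)
open import Relation.Binary.PropositionalEquality using (_≡_; _≢_; refl; sym; trans; cong; cong₂; subst; module ≡-Reasoning)
open import Relation.Nullary using (¬_; Dec; yes; no; does; contradiction)
open import Relation.Nullary.Decidable using (_⊎-dec_; dec-true)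
open import Relation.Unary using (Decidable)

-- The order of the stabiliser is never computed. A stabilising map that fixes 0 and 1 is the
-- identity on B, so it is enough to list m representatives of the ordered pairs: each may be
-- completed by any of the k - 1 remaining elements of B, which gives m (k - 1) blocks without a
-- division. Whether some stabilising map sends 1 to 0 decides everything, because the
-- multiplications by k-th roots of unity stabilise B and are transitive on its nonzero elements:
-- either 0 is always fixed, or B is a single orbit. The bound k ≥ 4 enters because the coefficients
-- of x, x², x³ and x⁴ are compared. If 2 ≠ 0, the first three alone leave k = 3 or k = -1 in the
-- field; in the former case c = 2, which is the exceptional map for k = 3.

-- Binomial coefficients and divisors of prime powers.

module _ where
  open import Data.Nat using (_+_; _*_)

  C-absorb : ∀ n k → suc k * (suc n C suc k) ≡ suc n * (n C k)
  C-absorb zero    zero    = refl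
  C-absorb zero    (suc k) = trans (cong (suc (suc k) *_) (k>n⇒nCk≡0 {1} {suc (suc k)} (ℕ.s≤s (ℕ.s≤s ℕ.z≤n))))
                                   (trans (ℕ.*-zeroʳ k) (sym (cong (1 *_) (k>n⇒nCk≡0 {0} {suc k} (ℕ.s≤s ℕ.z≤n)))))
  C-absorb (suc n) zero    = trans (ℕ.*-identityˡ _) (trans (nC1≡n (suc (suc n))) (sym (ℕ.*-identityʳ _)))
  C-absorb (suc n) (suc k) = begin
    suc (suc k) * (suc (suc n) C suc (suc k))
      ≡⟨ cong (suc (suc k) *_) (nCk+nC[k+1]≡[n+1]C[k+1] (suc n) (suc k)) ⟨
    suc (suc k) * (b + c)
      ≡⟨ +-*-Solver.solve 3 (λ k b c → (con 2 :+ k) :* (b :+ c) := b :+ (con 1 :+ k) :* b :+ (con 2 :+ k) :* c) refl k b c ⟩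
    b + suc k * b + suc (suc k) * c
      ≡⟨ cong₂ (λ u v → b + u + v) (C-absorb n k) (C-absorb n (suc k)) ⟩
    b + suc n * (n C k) + suc n * (n C suc k)
      ≡⟨ +-*-Solver.solve 4 (λ b n x y → b :+ n :* x :+ n :* y := b :+ n :* (x :+ y)) refl b (suc n) (n C k) (n C suc k) ⟩
    b + suc n * (n C k + n C suc k)
      ≡⟨ cong (λ u → b + suc n * u) (nCk+nC[k+1]≡[n+1]C[k+1] n k) ⟩
    suc (suc n) * b ∎
    where
    open ≡-Reasoning
    open +-*-Solver
    b = suc n C suc k
    c = suc n C suc (suc k)

  -- The recursion (i + 1) C(n, i + 1) = (n - i) C(n, i) without subtraction. Cast to the field, it
  -- ties `k C 2`, `k C 3` and `k C 4` to `k` without dividing by numbers that may vanish there.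
  C-step : ∀ n i → suc i * (n C suc i) + i * (n C i) ≡ n * (n C i)
  C-step zero zero = refl
  C-step zero (suc i) = trans (cong₂ (λ u v → suc (suc i) * u + suc i * v) (k>n⇒nCk≡0 {0} {suc (suc i)} ℕ.z<s) (k>n⇒nCk≡0 {0} {suc i} ℕ.z<s))
    (cong₂ _+_ (ℕ.*-zeroʳ i) (ℕ.*-zeroʳ i))
  C-step (suc m) zero = trans (ℕ.+-identityʳ _) (C-absorb m 0)
  C-step (suc m) (suc i) = begin
    suc (suc i) * (suc m C suc (suc i)) + suc i * (suc m C suc i) ≡⟨ cong₂ _+_ (C-absorb m (suc i)) (C-absorb m i) ⟩
    suc m * (m C suc i) + suc m * (m C i)                         ≡⟨ ℕ.*-distribˡ-+ (suc m) (m C suc i) (m C i) ⟨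
    suc m * (m C suc i + m C i)                                   ≡⟨ cong (suc m *_) (ℕ.+-comm (m C suc i) (m C i)) ⟩
    suc m * (m C i + m C suc i)                                   ≡⟨ cong (suc m *_) (nCk+nC[k+1]≡[n+1]C[k+1] m i) ⟩
    suc m * (suc m C suc i)                                       ∎
    where open ≡-Reasoning

  -- By `C-absorb`, p divides i · C(p, i), and it cannot divide i, which is smaller than p.
  prime∣pCi : ∀ {p i} → Prime p → 0 ℕ.< i → i ℕ.< p → p ∣ p C i
  prime∣pCi {suc p} {suc i} pp _ i<p
    with euclidsLemma (suc i) (suc p C suc i) pp (divides (p C i) (trans (C-absorb p i) (ℕ.*-comm (suc p) (p C i))))
  ... | inj₁ d = contradiction (∣⇒≤ d) (ℕ.<⇒≱ i<p)
  ... | inj₂ d = d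

  -- If p does not divide d, then d is coprime to p and one factor p can be cancelled. This turns k
  -- + 1 ∣ q into k + 1 = pᵐ, so that raising to the power k + 1 is an iterated Frobenius map.
  ∣-prime-power : ∀ {p} → Prime p → ∀ n {d} → d ∣ p ℕ.^ n → ∃ λ m → d ≡ p ℕ.^ m
  ∣-prime-power pp zero d∣1 = 0 , ∣1⇒≡1 d∣1
  ∣-prime-power {p} pp (suc n) {d} d∣ with p ∣? d
  ... | yes (divides e refl) =
        let e∣ = *-cancelˡ-∣ p {{prime⇒nonZero pp}} (subst (_∣ p * p ℕ.^ n) (ℕ.*-comm e p) d∣)
            m , eq = ∣-prime-power pp n e∣
        in suc m , trans (ℕ.*-comm e p) (cong (p *_) eq)
  ... | no p∤d = ∣-prime-power pp n (coprime-divisor coprime d∣)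
    where
    coprime : Coprime d p
    coprime {e} (e∣d , e∣p) with prime⇒irreducible pp e∣p
    ... | inj₁ e≡1 = e≡1
    ... | inj₂ refl = contradiction e∣d p∤d

-- Cardinalities of finite subsets.

x∉p-x : ∀ {n} (p : Subset n) x → x ∉ p ∖ x
x∉p-x (_ ∷ p) zero ()
x∉p-x (outside ∷ p) (suc x) (there m) = x∉p-x p x m
x∉p-x (inside ∷ p) (suc x) (there m) = x∉p-x p x m

x∈p⇒∣p∣≡1+∣p-x∣ : ∀ {n} {p : Subset n} {x} → x ∈ p → ∣ p ∣ ≡ suc ∣ p ∖ x ∣
x∈p⇒∣p∣≡1+∣p-x∣ {p = inside ∷ p} here = cong suc (cong ∣_∣ (sym (p─⊥≡p p)))
x∈p⇒∣p∣≡1+∣p-x∣ {p = inside ∷ p} (there m) = cong suc (x∈p⇒∣p∣≡1+∣p-x∣ m)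
x∈p⇒∣p∣≡1+∣p-x∣ {p = outside ∷ p} (there m) = x∈p⇒∣p∣≡1+∣p-x∣ m

∣p∣≡1+m⇒nonempty : ∀ {n m} (p : Subset n) → ∣ p ∣ ≡ suc m → ∃ λ x → x ∈ p × ∣ p ∖ x ∣ ≡ m
∣p∣≡1+m⇒nonempty p eq = let x , x∈p = nonempty p eq in
  x , x∈p , ℕ.suc-injective (trans (sym (x∈p⇒∣p∣≡1+∣p-x∣ x∈p)) eq)
  where
  nonempty : ∀ {n m} (p : Subset n) → ∣ p ∣ ≡ suc m → Nonempty p
  nonempty (inside ∷ p) eq = zero , here
  nonempty (outside ∷ p) eq = let x , x∈p = nonempty p eq in suc x , there x∈p

-- Serves two counts: an image that exhausts `S` leaves nothing over, and in Lagrange's theorem one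
-- coset is removed at a time.
remove-image : ∀ {m n} (S : Subset n) (f : Fin m → Fin n) → Injective _≡_ _≡_ f → (∀ i → f i ∈ S) →
               ∃ λ S′ → (∣ S ∣ ≡ m ℕ.+ ∣ S′ ∣) × (∀ y → (y ∈ S′) ⇔ (y ∈ S × ∀ i → f i ≢ y))
remove-image {zero}  S f inj f∈S = S , refl , λ y → mk⇔ (λ y∈S → y∈S , λ ()) proj₁
remove-image {suc m} S f inj f∈S
  with S′ , card , mem ← remove-image (S ∖ f zero) (f ∘ suc) (Fin.suc-injective ∘ inj)
                           (λ i → x∈p∧x≢y⇒x∈p-y (f∈S (suc i)) (λ eq → contradiction (inj eq) λ ()))
  = S′ , trans (x∈p⇒∣p∣≡1+∣p-x∣ (f∈S zero)) (cong suc card) , λ y → mk⇔ (to y) (from y)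
  where
  to : ∀ y → y ∈ S′ → y ∈ S × (∀ i → f i ≢ y)
  to y y∈ with y∈S-f0 , avoid ← Equivalence.to (mem y) y∈ =
    p─q⊆p S _ y∈S-f0 , λ { zero refl → x∉p-x S (f zero) y∈S-f0 ; (suc i) → avoid i }
  from : ∀ y → y ∈ S × (∀ i → f i ≢ y) → y ∈ S′
  from y (y∈S , avoid) = Equivalence.from (mem y) (x∈p∧x≢y⇒x∈p-y y∈S (avoid zero ∘ sym) , avoid ∘ suc)

card-image : ∀ {m n} (S : Subset n) (f : Fin m → Fin n) → Injective _≡_ _≡_ f →
             (∀ y → (y ∈ S) ⇔ (∃ λ i → f i ≡ y)) → ∣ S ∣ ≡ m
card-image {m} S f inj image
  with S′ , card , mem ← remove-image S f inj (λ i → Equivalence.from (image (f i)) (i , refl))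
  with ∣ S′ ∣ in eq
... | zero  = trans card (ℕ.+-identityʳ m)
... | suc _ with y , y∈S′ , _ ← ∣p∣≡1+m⇒nonempty S′ eq
            with y∈S , avoid ← Equivalence.to (mem y) y∈S′
            with i , fi≡y ← Equivalence.to (image y) y∈S = contradiction fi≡y (avoid i)

-- Field arithmetic and a ring solver.

module Field {q : ℕ} (F : FiniteFieldOn q) where
  open FiniteFieldOn F public

  commutativeRing : CommutativeRing 0ℓ 0ℓ
  commutativeRing = record { isCommutativeRing = isCommutativeRing }

  open CommutativeRing commutativeRing public using
    ( +-comm; +-assoc; +-identityˡ; +-identityʳ; -‿inverseʳ; *-comm; *-assoc; *-identityˡ; *-identityʳ
    ; zeroˡ; zeroʳ; ring; semiring; +-commutativeMonoid)
  open Algebra.Properties.Ring ring using (-‿involutive; -‿distribʳ-*; -‿distribˡ-*; -‿+-comm; -0#≈0#)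
  open Algebra.Properties.Semiring.Mult.TCOptimised semiring using (1+×; ×ᵤ≈×; ×1-homo-*; ×-homo-+)
    renaming (_×_ to _·_) public

  ι : ℕ → Fin q
  ι n = n · 1#

  ι-suc : ∀ n → ι (suc n) ≡ 1# + ι n
  ι-suc n = 1+× n 1#

  -- The canonical map from ℤ. The field operations are abstract and do not compute; integer
  -- coefficients do, so the solver can cancel terms and collect numerals in every characteristic.
  fromℤ : ℤ → Fin q
  fromℤ (pos n)    = ι n
  fromℤ -[1+ n ] = - ι (suc n)

  fromℤ-neg : ∀ i → fromℤ (ℤ.- i) ≡ - fromℤ i
  fromℤ-neg (pos zero)  = sym -0#≈0#
  fromℤ-neg (pos (suc n)) = refl
  fromℤ-neg -[1+ n ]  = sym (-‿involutive _)

  fromℤ-⊖ : ∀ m n → fromℤ (m ℤ.⊖ n) ≡ ι m + - ι n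
  fromℤ-⊖ m zero = sym (trans (cong (ι m +_) -0#≈0#) (+-identityʳ _))
  fromℤ-⊖ zero (suc n) = sym (+-identityˡ _)
  fromℤ-⊖ (suc m) (suc n) = begin
    fromℤ (suc m ℤ.⊖ suc n)        ≡⟨ cong fromℤ (ℤ.[1+m]⊖[1+n]≡m⊖n m n) ⟩
    fromℤ (m ℤ.⊖ n)                ≡⟨ fromℤ-⊖ m n ⟩
    ι m + - ι n                    ≡⟨ cong (_+ - ι n) (+-identityʳ (ι m)) ⟨
    ι m + 0# + - ι n               ≡⟨ cong (λ z → ι m + z + - ι n) (-‿inverseʳ 1#) ⟨
    ι m + (1# + - 1#) + - ι n      ≡⟨ cong (_+ - ι n) (+-assoc (ι m) 1# (- 1#)) ⟨
    ι m + 1# + - 1# + - ι n        ≡⟨ +-assoc _ _ _ ⟩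
    ι m + 1# + (- 1# + - ι n)      ≡⟨ cong₂ _+_ (trans (+-comm (ι m) 1#) (sym (ι-suc m))) (trans (-‿+-comm 1# (ι n)) (cong -_ (sym (ι-suc n)))) ⟩
    ι (suc m) + - ι (suc n)        ∎
    where open ≡-Reasoning

  fromℤ-+ : ∀ i j → fromℤ (i ℤ.+ j) ≡ fromℤ i + fromℤ j
  fromℤ-+ (pos m)    (pos n)    = ×-homo-+ 1# m n
  fromℤ-+ (pos m)    -[1+ n ] = fromℤ-⊖ m (suc n)
  fromℤ-+ -[1+ m ] (pos n)    = trans (fromℤ-⊖ n (suc m)) (+-comm _ _)
  fromℤ-+ -[1+ m ] -[1+ n ] = begin
    - ι (suc (suc (m ℕ.+ n)))     ≡⟨ cong (λ z → - ι (suc z)) (ℕ.+-suc m n) ⟨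
    - ι (suc m ℕ.+ suc n)         ≡⟨ cong -_ (×-homo-+ 1# (suc m) (suc n)) ⟩
    - (ι (suc m) + ι (suc n))     ≡⟨ -‿+-comm _ _ ⟨
    - ι (suc m) + - ι (suc n)     ∎
    where open ≡-Reasoning

  fromℤ-*ˡ : ∀ m j → fromℤ (pos m ℤ.* j) ≡ ι m * fromℤ j
  fromℤ-*ˡ m (pos n) = trans (cong fromℤ (sym (ℤ.pos-* m n))) (×1-homo-* m n)
  fromℤ-*ˡ m -[1+ n ] = begin
    fromℤ (pos m ℤ.* -[1+ n ])         ≡⟨ cong fromℤ (ℤ.neg-distribʳ-* (pos m) (pos (suc n))) ⟨
    fromℤ (ℤ.- (pos m ℤ.* pos (suc n)))    ≡⟨ fromℤ-neg (pos m ℤ.* pos (suc n)) ⟩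
    - fromℤ (pos m ℤ.* pos (suc n))        ≡⟨ cong -_ (fromℤ-*ˡ m (pos (suc n))) ⟩
    - (ι m * ι (suc n))              ≡⟨ -‿distribʳ-* _ _ ⟩
    ι m * - ι (suc n)                ∎
    where open ≡-Reasoning

  fromℤ-* : ∀ i j → fromℤ (i ℤ.* j) ≡ fromℤ i * fromℤ j
  fromℤ-* (pos m)    j = fromℤ-*ˡ m j
  fromℤ-* -[1+ m ] j = begin
    fromℤ (-[1+ m ] ℤ.* j)           ≡⟨ cong fromℤ (ℤ.neg-distribˡ-* (pos (suc m)) j) ⟨
    fromℤ (ℤ.- (pos (suc m) ℤ.* j))      ≡⟨ fromℤ-neg (pos (suc m) ℤ.* j) ⟩
    - fromℤ (pos (suc m) ℤ.* j)          ≡⟨ cong -_ (fromℤ-*ˡ (suc m) j) ⟩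
    - (ι (suc m) * fromℤ j)          ≡⟨ -‿distribˡ-* _ _ ⟩
    - ι (suc m) * fromℤ j            ∎
    where open ≡-Reasoning

  ℤ-morphism : ℤ.+-*-rawRing -Raw-AlmostCommutative⟶ fromCommutativeRing commutativeRing
  ℤ-morphism = record
    { ⟦_⟧ = fromℤ ; +-homo = fromℤ-+ ; *-homo = fromℤ-* ; -‿homo = fromℤ-neg ; 0-homo = refl ; 1-homo = refl }

  ℤ-weaklyDecidable : WeaklyDecidable (Induced-equivalence ℤ-morphism)
  ℤ-weaklyDecidable i j with i ℤ.≟ j
  ... | yes i≡j = just (cong fromℤ i≡j)
  ... | no  _   = nothing

  open Algebra.Solver.Ring ℤ.+-*-rawRing (fromCommutativeRing commutativeRing) ℤ-morphism ℤ-weaklyDecidable public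
    using (solve; _:=_; _:+_; _:*_; :-_; con; Polynomial)

  1: 0: : ∀ {n} → Polynomial n
  1: = con (pos 1)
  0: = con (pos 0)

  x-y≡0⇒x≡y : ∀ {x y} → x + - y ≡ 0# → x ≡ y
  x-y≡0⇒x≡y {x} {y} eq = begin
    x              ≡⟨ solve 2 (λ x y → x := x :+ :- y :+ y) refl x y ⟩
    x + - y + y    ≡⟨ cong (_+ y) eq ⟩
    0# + y         ≡⟨ +-identityˡ y ⟩
    y              ∎
    where open ≡-Reasoning

  x≡y⇒x-y≡0 : ∀ {x y} → x ≡ y → x + - y ≡ 0#
  x≡y⇒x-y≡0 refl = -‿inverseʳ _

  inverseˡ : ∀ x → x ≢ 0# → x ⁻¹ * x ≡ 1#
  inverseˡ x x≢0 = trans (*-comm _ _) (inverse x x≢0)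

  xy≡0⇒y≡0 : ∀ {x y} → x ≢ 0# → x * y ≡ 0# → y ≡ 0#
  xy≡0⇒y≡0 {x} {y} x≢0 eq = begin
    y              ≡⟨ *-identityˡ y ⟨
    1# * y         ≡⟨ cong (_* y) (inverseˡ x x≢0) ⟨
    x ⁻¹ * x * y   ≡⟨ *-assoc _ _ _ ⟩
    x ⁻¹ * (x * y) ≡⟨ cong (x ⁻¹ *_) eq ⟩
    x ⁻¹ * 0#      ≡⟨ zeroʳ _ ⟩
    0#             ∎
    where open ≡-Reasoning

  xy≢0 : ∀ {x y} → x ≢ 0# → y ≢ 0# → x * y ≢ 0#
  xy≢0 x≢0 y≢0 eq = y≢0 (xy≡0⇒y≡0 x≢0 eq)

  *-cancelˡ : ∀ {x y z} → x ≢ 0# → x * y ≡ x * z → y ≡ z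
  *-cancelˡ {x} {y} {z} x≢0 eq = x-y≡0⇒x≡y (xy≡0⇒y≡0 x≢0 (trans
    (solve 3 (λ x y z → x :* (y :+ :- z) := x :* y :+ :- (x :* z)) refl x y z) (x≡y⇒x-y≡0 eq)))

  x⁻¹≢0 : ∀ {x} → x ≢ 0# → x ⁻¹ ≢ 0#
  x⁻¹≢0 {x} x≢0 eq = 0≢1 (trans (sym (zeroʳ x)) (trans (cong (x *_) (sym eq)) (inverse x x≢0)))

  1≢0 : 1# ≢ 0#
  1≢0 = 0≢1 ∘ sym

  ^-+ : ∀ x m n → x ^ (m ℕ.+ n) ≡ x ^ m * x ^ n
  ^-+ x zero    n = sym (*-identityˡ _)
  ^-+ x (suc m) n = trans (cong (x *_) (^-+ x m n)) (sym (*-assoc _ _ _))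

  1^n≡1 : ∀ n → 1# ^ n ≡ 1#
  1^n≡1 zero    = refl
  1^n≡1 (suc n) = trans (*-identityˡ _) (1^n≡1 n)

  ^-distrib-* : ∀ x y n → (x * y) ^ n ≡ x ^ n * y ^ n
  ^-distrib-* x y zero    = sym (*-identityˡ _)
  ^-distrib-* x y (suc n) = trans (cong (x * y *_) (^-distrib-* x y n))
    (solve 4 (λ x y u v → x :* y :* (u :* v) := x :* u :* (y :* v)) refl x y (x ^ n) (y ^ n))

  ^-* : ∀ x m n → x ^ (m ℕ.* n) ≡ (x ^ n) ^ m
  ^-* x zero    n = refl
  ^-* x (suc m) n = trans (^-+ x n (m ℕ.* n)) (cong (x ^ n *_) (^-* x m n))

  x^n≢0 : ∀ {x} n → x ≢ 0# → x ^ n ≢ 0#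
  x^n≢0 zero    x≢0 = 1≢0
  x^n≢0 (suc n) x≢0 = xy≢0 x≢0 (x^n≢0 n x≢0)

  -- Translation by 1 permutes the field, so summing all elements gives q · 1 = 0.
  ιq≡0 : ι q ≡ 0#
  ιq≡0 = begin
    ι q                                       ≡⟨ trans (sum-replicate q) (×ᵤ≈× q 1#) ⟨
    sum {q} (λ _ → 1#)                        ≡⟨ solve 2 (λ s t → s := t :+ s :+ :- t) refl (sum {q} (λ _ → 1#)) (sum id′) ⟩
    sum id′ + sum {q} (λ _ → 1#) + - sum id′  ≡⟨ cong (_+ - sum id′) (∑-distrib-+ id′ (λ _ → 1#)) ⟨
    sum (λ x → x + 1#) + - sum id′            ≡⟨ cong (_+ - sum id′) (sum-permute id′ shift) ⟨
    sum id′ + - sum id′                       ≡⟨ -‿inverseʳ _ ⟩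
    0#                                        ∎
    where
    open ≡-Reasoning
    open Algebra.Properties.CommutativeMonoid.Sum +-commutativeMonoid
    id′ : Fin q → Fin q
    id′ x = x
    shift : Permutation q q
    shift = permutation (_+ 1#) (_+ - 1#)
      (λ x → solve 1 (λ x → x :+ :- 1: :+ 1: := x) refl x)
      (λ x → solve 1 (λ x → x :+ 1: :+ :- 1: := x) refl x)

-- Polynomials, their roots, and the Frobenius map.

module Polynomials {q : ℕ} (F : FiniteFieldOn q) where
  open Field F
  open ≡-Reasoning

  -- Horner evaluation of Σ aᵢ xⁱ over i < n. The first argument counts terms, so it exceeds the
  -- formal degree by one; later entries of the sequence are ignored.
  eval : ℕ → (ℕ → Fin q) → Fin q → Fin q
  eval zero    a x = 0#
  eval (suc n) a x = a 0 + x * eval n (a ∘ suc) x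

  eval-last : ∀ n a x → eval (suc n) a x ≡ eval n a x + a n * x ^ n
  eval-last zero    a x = solve 2 (λ a x → a :+ x :* 0: := 0: :+ a :* 1:) refl (a 0) x
  eval-last (suc n) a x = begin
    a 0 + x * eval (suc n) (a ∘ suc) x
      ≡⟨ cong (λ z → a 0 + x * z) (eval-last n (a ∘ suc) x) ⟩
    a 0 + x * (eval n (a ∘ suc) x + a (suc n) * x ^ n)
      ≡⟨ solve 5 (λ u x e v y → u :+ x :* (e :+ v :* y) := u :+ x :* e :+ v :* (x :* y)) refl
           (a 0) x (eval n (a ∘ suc) x) (a (suc n)) (x ^ n) ⟩
    a 0 + x * eval n (a ∘ suc) x + a (suc n) * (x * x ^ n) ∎

  eval-linear : ∀ n a s b x → eval n (λ i → a i + s * b i) x ≡ eval n a x + s * eval n b x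
  eval-linear zero    a s b x = solve 1 (λ s → 0: := 0: :+ s :* 0:) refl s
  eval-linear (suc n) a s b x = trans
    (cong (λ z → a 0 + s * b 0 + x * z) (eval-linear n (a ∘ suc) s (b ∘ suc) x))
    (solve 6 (λ u s v x e f → u :+ s :* v :+ x :* (e :+ s :* f) := u :+ x :* e :+ s :* (v :+ x :* f)) refl
       (a 0) s (b 0) x (eval n (a ∘ suc) x) (eval n (b ∘ suc) x))

  eval-cong : ∀ n {a b} x → (∀ i → i ℕ.< n → a i ≡ b i) → eval n a x ≡ eval n b x
  eval-cong zero    x a≡b = refl
  eval-cong (suc n) x a≡b =
    cong₂ (λ u v → u + x * v) (a≡b 0 ℕ.z<s) (eval-cong n x (λ i i<n → a≡b (suc i) (ℕ.s<s i<n)))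

  eval-zero : ∀ n {a} x → (∀ i → i ℕ.< n → a i ≡ 0#) → eval n a x ≡ 0#
  eval-zero zero    x a≡0 = refl
  eval-zero (suc n) x a≡0 = trans
    (cong₂ (λ u v → u + x * v) (a≡0 0 ℕ.z<s) (eval-zero n x (λ i i<n → a≡0 (suc i) (ℕ.s<s i<n))))
    (trans (+-identityˡ _) (zeroʳ x))

  -- The coefficients of the quotient of Σ_{i≤n} bᵢ xⁱ by x − r, where aᵢ = bᵢ₊₁.
  quotient : ℕ → (ℕ → Fin q) → Fin q → ℕ → Fin q
  quotient zero    a r _       = 0#
  quotient (suc n) a r zero    = eval (suc n) a r
  quotient (suc n) a r (suc i) = quotient n (a ∘ suc) r i

  eval-quotient : ∀ n a r x →
    eval (suc n) a x + - eval (suc n) a r ≡ (x + - r) * eval n (quotient n (a ∘ suc) r) x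
  eval-quotient zero    a r x =
    solve 3 (λ a r x → (a :+ x :* 0:) :+ :- (a :+ r :* 0:) := (x :+ :- r) :* 0:) refl (a 0) r x
  eval-quotient (suc n) a r x = begin
    a 0 + x * X + - (a 0 + r * R)
      ≡⟨ solve 5 (λ u x X r R → u :+ x :* X :+ :- (u :+ r :* R) := (x :+ :- r) :* R :+ x :* (X :+ :- R)) refl (a 0) x X r R ⟩
    (x + - r) * R + x * (X + - R)
      ≡⟨ cong (λ z → (x + - r) * R + x * z) (eval-quotient n (a ∘ suc) r x) ⟩
    (x + - r) * R + x * ((x + - r) * Q)
      ≡⟨ solve 4 (λ x r R Q → (x :+ :- r) :* R :+ x :* ((x :+ :- r) :* Q) := (x :+ :- r) :* (R :+ x :* Q)) refl x r R Q ⟩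
    (x + - r) * (R + x * Q) ∎
    where
    X = eval (suc n) (a ∘ suc) x
    R = eval (suc n) (a ∘ suc) r
    Q = eval n (quotient n ((a ∘ suc) ∘ suc) r) x

  quotient≡0⇒≡0 : ∀ n a r → (∀ i → i ℕ.< n → quotient n a r i ≡ 0#) → ∀ i → i ℕ.< n → a i ≡ 0#
  quotient≡0⇒≡0 (suc n) a r Q≡0 = λ
    { zero    _           → begin
        a 0                             ≡⟨ solve 2 (λ a r → a := a :+ r :* 0:) refl (a 0) r ⟩
        a 0 + r * 0#                    ≡⟨ cong (λ z → a 0 + r * z) (eval-zero n r rest) ⟨
        a 0 + r * eval n (a ∘ suc) r    ≡⟨ Q≡0 0 ℕ.z<s ⟩
        0#                              ∎
    ; (suc i) (ℕ.s≤s i<n) → rest i i<n }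
    where
    rest : ∀ i → i ℕ.< n → a (suc i) ≡ 0#
    rest = quotient≡0⇒≡0 n (a ∘ suc) r (λ i i<n → Q≡0 (suc i) (ℕ.s<s i<n))

  -- Splitting off x - ρ 0 leaves one term and one root fewer. Through this lemma, an identity that
  -- holds at roots of unity becomes a set of equations between coefficients.
  roots⇒≡0 : ∀ n a (ρ : Fin n → Fin q) → Injective _≡_ _≡_ ρ → (∀ j → eval n a (ρ j) ≡ 0#) →
             ∀ i → i ℕ.< n → a i ≡ 0#
  roots⇒≡0 (suc n) a ρ inj root = λ
    { zero    _           → begin
        a 0                             ≡⟨ solve 2 (λ a r → a := a :+ r :* 0:) refl (a 0) r ⟩
        a 0 + r * 0#                    ≡⟨ cong (λ z → a 0 + r * z) (eval-zero n r rest) ⟨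
        a 0 + r * eval n (a ∘ suc) r    ≡⟨ root zero ⟩
        0#                              ∎
    ; (suc i) (ℕ.s≤s i<n) → rest i i<n }
    where
    r = ρ zero
    quotient-root : ∀ j → eval n (quotient n (a ∘ suc) r) (ρ (suc j)) ≡ 0#
    quotient-root j = xy≡0⇒y≡0 (λ eq → contradiction (inj (x-y≡0⇒x≡y eq)) λ ())
      (trans (sym (eval-quotient n a r (ρ (suc j)))) (x≡y⇒x-y≡0 (trans (root (suc j)) (sym (root zero)))))
    rest : ∀ i → i ℕ.< n → a (suc i) ≡ 0#
    rest = quotient≡0⇒≡0 n (a ∘ suc) r
      (roots⇒≡0 n (quotient n (a ∘ suc) r) (ρ ∘ suc) (Fin.suc-injective ∘ inj) quotient-root)

  geometric : ∀ n x → (1# + - x) * eval n (λ _ → 1#) x ≡ 1# + - (x ^ n)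
  geometric zero    x = solve 1 (λ x → (1: :+ :- x) :* 0: := 1: :+ :- 1:) refl x
  geometric (suc n) x = begin
    (1# + - x) * (1# + x * e)          ≡⟨ solve 2 (λ x e → (1: :+ :- x) :* (1: :+ x :* e) := 1: :+ :- x :+ x :* ((1: :+ :- x) :* e)) refl x e ⟩
    1# + - x + x * ((1# + - x) * e)    ≡⟨ cong (λ z → 1# + - x + x * z) (geometric n x) ⟩
    1# + - x + x * (1# + - (x ^ n))    ≡⟨ solve 2 (λ x y → 1: :+ :- x :+ x :* (1: :+ :- y) := 1: :+ :- (x :* y)) refl x (x ^ n) ⟩
    1# + - (x * x ^ n)                 ∎
    where e = eval n (λ _ → 1#) x

  binomialCoeff : ℕ → Fin q → ℕ → Fin q
  binomialCoeff n c i = ι (n C i) * c ^ i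

  binomialCoeff-pascal : ∀ n c i →
    binomialCoeff (suc n) c (suc i) ≡ binomialCoeff n c (suc i) + c * binomialCoeff n c i
  binomialCoeff-pascal n c i = begin
    ι (suc n C suc i) * (c * c ^ i)                    ≡⟨ cong (λ z → ι z * (c * c ^ i)) (nCk+nC[k+1]≡[n+1]C[k+1] n i) ⟨
    ι (n C i ℕ.+ n C suc i) * (c * c ^ i)              ≡⟨ cong (_* (c * c ^ i)) (×-homo-+ 1# (n C i) (n C suc i)) ⟩
    (ι (n C i) + ι (n C suc i)) * (c * c ^ i)
      ≡⟨ solve 4 (λ u v c y → (u :+ v) :* (c :* y) := v :* (c :* y) :+ c :* (u :* y)) refl (ι (n C i)) (ι (n C suc i)) c (c ^ i) ⟩
    ι (n C suc i) * (c * c ^ i) + c * (ι (n C i) * c ^ i) ∎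

  binomial : ∀ n c x → eval (suc n) (binomialCoeff n c) x ≡ (1# + c * x) ^ n
  binomial zero    c x = solve 1 (λ x → 1: :* 1: :+ x :* 0: := 1:) refl x
  binomial (suc n) c x = begin
    b (suc n) 0 + x * eval (suc n) (b (suc n) ∘ suc) x
      ≡⟨ cong (λ z → b n 0 + x * z) (eval-cong (suc n) x (λ i _ → binomialCoeff-pascal n c i)) ⟩
    b n 0 + x * eval (suc n) (λ i → b n (suc i) + c * b n i) x
      ≡⟨ cong (λ z → b n 0 + x * z) (eval-linear (suc n) (b n ∘ suc) c (b n) x) ⟩
    b n 0 + x * (eval (suc n) (b n ∘ suc) x + c * e)
      ≡⟨ solve 5 (λ u x v c e → u :+ x :* (v :+ c :* e) := u :+ x :* v :+ c :* x :* e) refl (b n 0) x (eval (suc n) (b n ∘ suc) x) c e ⟩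
    -- The shifted sum runs one index too far for `e`; the surplus coefficient is `n C suc n`, which
    -- is 0.
    eval (suc (suc n)) (b n) x + c * x * e
      ≡⟨ cong (_+ c * x * e) (eval-last (suc n) (b n) x) ⟩
    e + ι (n C suc n) * c ^ suc n * x ^ suc n + c * x * e
      ≡⟨ cong (λ z → e + ι z * c ^ suc n * x ^ suc n + c * x * e) (k>n⇒nCk≡0 {n} (ℕ.n<1+n n)) ⟩
    e + 0# * c ^ suc n * x ^ suc n + c * x * e
      ≡⟨ solve 5 (λ e u v c x → e :+ 0: :* u :* v :+ c :* x :* e := (1: :+ c :* x) :* e) refl e (c ^ suc n) (x ^ suc n) c x ⟩
    (1# + c * x) * e
      ≡⟨ cong ((1# + c * x) *_) (binomial n c x) ⟩
    (1# + c * x) ^ suc n ∎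
    where
    b = λ n → binomialCoeff n c
    e = eval (suc n) (b n) x

  ι-∣ : ∀ {m n} → m ∣ n → ι m ≡ 0# → ι n ≡ 0#
  ι-∣ {m} (divides d refl) ιm≡0 = trans (×1-homo-* d m) (trans (cong (ι d *_) ιm≡0) (zeroʳ _))

  ι-^ : ∀ m n → ι (m ℕ.^ n) ≡ ι m ^ n
  ι-^ m zero    = refl
  ι-^ m (suc n) = trans (×1-homo-* m (m ℕ.^ n)) (cong (ι m *_) (ι-^ m n))

  -- All binomial coefficients strictly between the ends are multiples of p and vanish in the field.
  frobenius : ∀ {p} → Prime p → ι p ≡ 0# → ∀ x → (1# + x) ^ p ≡ 1# + x ^ p
  frobenius {zero} pp = contradiction pp ¬prime[0]
  frobenius {suc p′} pp ιp≡0 x = begin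
    (1# + x) ^ suc p′                       ≡⟨ cong (λ z → (1# + z) ^ suc p′) (*-identityˡ x) ⟨
    (1# + 1# * x) ^ suc p′                  ≡⟨ binomial (suc p′) 1# x ⟨
    1# * 1# + x * eval (suc p′) (b ∘ suc) x ≡⟨ cong (λ z → 1# * 1# + x * z) (eval-last p′ (b ∘ suc) x) ⟩
    1# * 1# + x * (eval p′ (b ∘ suc) x + b (suc p′) * x ^ p′)
      ≡⟨ cong₂ (λ u v → 1# * 1# + x * (u + v * x ^ p′)) (eval-zero p′ x middle) top ⟩
    1# * 1# + x * (0# + 1# * x ^ p′)
      ≡⟨ solve 2 (λ x y → 1: :* 1: :+ x :* (0: :+ 1: :* y) := 1: :+ x :* y) refl x (x ^ p′) ⟩
    1# + x ^ suc p′                         ∎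
    where
    b = binomialCoeff (suc p′) 1#
    middle : ∀ i → i ℕ.< p′ → b (suc i) ≡ 0#
    middle i i<p′ = trans (cong (_* 1# ^ suc i) (ι-∣ (prime∣pCi pp ℕ.z<s (ℕ.s<s i<p′)) ιp≡0)) (zeroˡ _)
    top : b (suc p′) ≡ 1#
    top = trans (cong₂ _*_ (cong ι (nCn≡1 (suc p′))) (1^n≡1 (suc p′))) (*-identityˡ 1#)

  frobenius-^ : ∀ {p} → Prime p → ι p ≡ 0# → ∀ m x → (1# + x) ^ (p ℕ.^ m) ≡ 1# + x ^ (p ℕ.^ m)
  frobenius-^ pp ιp≡0 zero    x = solve 1 (λ x → (1: :+ x) :* 1: := 1: :+ x :* 1:) refl x
  frobenius-^ {p} pp ιp≡0 (suc m) x = begin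
    (1# + x) ^ (p ℕ.* P)      ≡⟨ ^-* (1# + x) p P ⟩
    ((1# + x) ^ P) ^ p        ≡⟨ cong (_^ p) (frobenius-^ pp ιp≡0 m x) ⟩
    (1# + x ^ P) ^ p          ≡⟨ frobenius pp ιp≡0 (x ^ P) ⟩
    1# + (x ^ P) ^ p          ≡⟨ cong (1# +_) (^-* x p P) ⟨
    1# + x ^ (p ℕ.* P)        ∎
    where P = p ℕ.^ m

  -- In the field (p · 1)ⁿ = q · 1 = 0, and a nonzero element has no vanishing power.
  q≡p^n⇒ιp≡0 : ∀ {p} n → q ≡ p ℕ.^ n → ι p ≡ 0#
  q≡p^n⇒ιp≡0 {p} n q≡p^n with ι p ≟ 0#
  ... | yes eq = eq
  ... | no neq = contradiction (trans (sym (ι-^ p n)) (trans (cong ι (sym q≡p^n)) ιq≡0)) (x^n≢0 n neq)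

-- The projective line and PGL(2,q).

module ProjectiveLine {q : ℕ} (F : FiniteFieldOn q) where
  open Field F
  open ≡-Reasoning

  X : Set
  X = Fin (suc q)

  pattern ∞ = zero

  num den : X → Fin q
  num ∞       = 1#
  num (suc x) = x
  den ∞       = 0#
  den (suc x) = 1#

  -- Homogeneous coordinates (u : v) of `P`. In them the action is linear, so the case distinctions
  -- for ∞ in `act` are dealt with once and identities of maps become polynomial identities up to a
  -- scalar.
  record Coords (P : X) (u v : Fin q) : Set where
    constructor coordinates
    field
      scale   : Fin q
      scale≢0 : scale ≢ 0#
      u≡      : u ≡ scale * num P
      v≡      : v ≡ scale * den P

  coords : ∀ P → Coords P (num P) (den P)
  coords P = coordinates 1# 1≢0 (sym (*-identityˡ _)) (sym (*-identityˡ _))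

  coords-scale : ∀ {P u v} t → t ≢ 0# → Coords P u v → Coords P (t * u) (t * v)
  coords-scale t t≢0 (coordinates s s≢0 refl refl) =
    coordinates (t * s) (xy≢0 t≢0 s≢0) (sym (*-assoc _ _ _)) (sym (*-assoc _ _ _))

  point : Fin q → Fin q → X
  point u v with v ≟ 0#
  ... | yes _ = ∞
  ... | no  _ = suc (u * v ⁻¹)

  point-coords : ∀ {u v} → (v ≡ 0# → u ≢ 0#) → Coords (point u v) u v
  point-coords {u} {v} uv≢0 with v ≟ 0#
  ... | yes v≡0 = coordinates u (uv≢0 v≡0) (sym (*-identityʳ u)) (trans v≡0 (sym (zeroʳ u)))
  ... | no  v≢0 = coordinates v v≢0 u≡v[u/v] (sym (*-identityʳ v))
    where
    u≡v[u/v] : u ≡ v * (u * v ⁻¹)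
    u≡v[u/v] = begin
      u               ≡⟨ *-identityʳ u ⟨
      u * 1#          ≡⟨ cong (u *_) (inverse v v≢0) ⟨
      u * (v * v ⁻¹)  ≡⟨ solve 3 (λ u v w → u :* (v :* w) := v :* (u :* w)) refl u v (v ⁻¹) ⟩
      v * (u * v ⁻¹)  ∎

  coords-point : ∀ {P u v} → Coords P u v → point u v ≡ P
  coords-point {∞} {u} {v} (coordinates s s≢0 _ v≡s0) with v ≟ 0#
  ... | yes _   = refl
  ... | no  v≢0 = contradiction (trans v≡s0 (zeroʳ s)) v≢0
  coords-point {suc x} {u} {v} (coordinates s s≢0 u≡sx v≡s1) with v ≟ 0#
  ... | yes v≡0 = contradiction (trans (sym (*-identityʳ s)) (trans (sym v≡s1) v≡0)) s≢0
  ... | no  v≢0 = cong suc (begin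
      u * v ⁻¹        ≡⟨ cong (_* v ⁻¹) (trans u≡sx (cong (_* x) (trans (sym (*-identityʳ s)) (sym v≡s1)))) ⟩
      v * x * v ⁻¹    ≡⟨ solve 3 (λ v x w → v :* x :* w := x :* (v :* w)) refl v x (v ⁻¹) ⟩
      x * (v * v ⁻¹)  ≡⟨ cong (x *_) (inverse v v≢0) ⟩
      x * 1#          ≡⟨ *-identityʳ x ⟩
      x               ∎)

  coords-unique : ∀ {P Q u v} → Coords P u v → Coords Q u v → P ≡ Q
  coords-unique cP cQ = trans (sym (coords-point cP)) (coords-point cQ)

  coords-≡ : ∀ {P u v u′ v′} → u ≡ u′ → v ≡ v′ → Coords P u v → Coords P u′ v′
  coords-≡ refl refl c = c

  coords-suc : ∀ {x u v} → Coords (suc x) u v → v ≢ 0# × u ≡ v * x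
  coords-suc {x} (coordinates s s≢0 refl refl) =
    (λ eq → s≢0 (trans (sym (*-identityʳ s)) eq)) , cong (_* x) (sym (*-identityʳ s))

  suc-coords : ∀ {x v} → v ≢ 0# → Coords (suc x) (v * x) v
  suc-coords {x} {v} v≢0 = coordinates v v≢0 refl (sym (*-identityʳ v))

  -- Matrices rather than classes modulo scalars: maps are compared only through their values on
  -- `X`.
  record PGL : Set where
    no-eta-equality
    pattern
    constructor pgl
    field
      a b c d : Fin q
      det≢0   : a * d + - (b * c) ≢ 0#

  infixr 5 _⟨$⟩_
  _⟨$⟩_ : PGL → X → X
  pgl a b c d _ ⟨$⟩ P = act a b c d P

  act≡point : ∀ a b c d P → act a b c d P ≡ point (a * num P + b * den P) (c * num P + d * den P)
  act≡point a b c d ∞ = trans lemma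
    (cong₂ point (solve 2 (λ a b → a := a :* 1: :+ b :* 0:) refl a b) (solve 2 (λ a b → a := a :* 1: :+ b :* 0:) refl c d))
    where
    lemma : act a b c d ∞ ≡ point a c
    lemma with c ≟ 0#
    ... | yes _ = refl
    ... | no  _ = refl
  act≡point a b c d (suc x) = trans lemma
    (cong₂ (λ u v → point (a * x + u) (c * x + v)) (sym (*-identityʳ b)) (sym (*-identityʳ d)))
    where
    lemma : act a b c d (suc x) ≡ point (a * x + b) (c * x + d)
    lemma with (c * x + d) ≟ 0#
    ... | yes _ = refl
    ... | no  _ = refl

  private
    -- Applying the adjugate to the image vector gives det · (n, m). If the image were (0, 0), both
    -- coordinates of `P` would vanish.
    nonzero : ∀ {a b c d} → a * d + - (b * c) ≢ 0# → ∀ P → c * num P + d * den P ≡ 0# → a * num P + b * den P ≢ 0#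
    nonzero {a} {b} {c} {d} det≢0 P v≡0 u≡0 = 1≢0 (one P (xy≡0⇒y≡0 det≢0 det*num) (xy≡0⇒y≡0 det≢0 det*den))
      where
      n = num P
      m = den P
      det*num : (a * d + - (b * c)) * n ≡ 0#
      det*num = begin
        (a * d + - (b * c)) * n
          ≡⟨ solve 6 (λ a b c d n m → (a :* d :+ :- (b :* c)) :* n := d :* (a :* n :+ b :* m) :+ :- (b :* (c :* n :+ d :* m))) refl a b c d n m ⟩
        d * (a * n + b * m) + - (b * (c * n + d * m))
          ≡⟨ cong₂ (λ u v → d * u + - (b * v)) u≡0 v≡0 ⟩
        d * 0# + - (b * 0#)
          ≡⟨ solve 2 (λ b d → d :* 0: :+ :- (b :* 0:) := 0:) refl b d ⟩
        0# ∎
      det*den : (a * d + - (b * c)) * m ≡ 0#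
      det*den = begin
        (a * d + - (b * c)) * m
          ≡⟨ solve 6 (λ a b c d n m → (a :* d :+ :- (b :* c)) :* m := a :* (c :* n :+ d :* m) :+ :- (c :* (a :* n :+ b :* m))) refl a b c d n m ⟩
        a * (c * n + d * m) + - (c * (a * n + b * m))
          ≡⟨ cong₂ (λ u v → a * v + - (c * u)) u≡0 v≡0 ⟩
        a * 0# + - (c * 0#)
          ≡⟨ solve 2 (λ a c → a :* 0: :+ :- (c :* 0:) := 0:) refl a c ⟩
        0# ∎
      one : ∀ P → num P ≡ 0# → den P ≡ 0# → 1# ≡ 0#
      one ∞       eq _ = eq
      one (suc _) _ eq = eq

  ⟨$⟩-coords : ∀ M {P u v} → Coords P u v →
               Coords (M ⟨$⟩ P) (PGL.a M * u + PGL.b M * v) (PGL.c M * u + PGL.d M * v)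
  ⟨$⟩-coords (pgl a b c d det≢0) {P} (coordinates s s≢0 refl refl) = subst (λ Q → Coords Q _ _) (sym (act≡point a b c d P))
    (coords-≡ (factor a b) (factor c d) (coords-scale s s≢0 (point-coords (nonzero det≢0 P))))
    where
    factor : ∀ a b → s * (a * num P + b * den P) ≡ a * (s * num P) + b * (s * den P)
    factor a b = solve 5 (λ s a n b m → s :* (a :* n :+ b :* m) := a :* (s :* n) :+ b :* (s :* m)) refl s a (num P) b (den P)

  infixr 9 _⊙_
  _⊙_ : PGL → PGL → PGL
  pgl a b c d det ⊙ pgl a′ b′ c′ d′ det′ =
    pgl (a * a′ + b * c′) (a * b′ + b * d′) (c * a′ + d * c′) (c * b′ + d * d′)
      (xy≢0 det det′ ∘ trans (solve 8 (λ a b c d a′ b′ c′ d′ →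
          (a :* d :+ :- (b :* c)) :* (a′ :* d′ :+ :- (b′ :* c′))
          := (a :* a′ :+ b :* c′) :* (c :* b′ :+ d :* d′) :+ :- ((a :* b′ :+ b :* d′) :* (c :* a′ :+ d :* c′)))
        refl a b c d a′ b′ c′ d′))

  ⊙-⟨$⟩ : ∀ M N P → M ⊙ N ⟨$⟩ P ≡ M ⟨$⟩ N ⟨$⟩ P
  ⊙-⟨$⟩ M@(pgl a b c d _) N@(pgl a′ b′ c′ d′ _) P = coords-unique
    (⟨$⟩-coords (M ⊙ N) (coords P))
    (coords-≡ (row a b) (row c d) (⟨$⟩-coords M (⟨$⟩-coords N (coords P))))
    where
    row : ∀ a b → a * (a′ * num P + b′ * den P) + b * (c′ * num P + d′ * den P)
                ≡ (a * a′ + b * c′) * num P + (a * b′ + b * d′) * den P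
    row a b = solve 8 (λ a b a′ b′ c′ d′ n m →
      a :* (a′ :* n :+ b′ :* m) :+ b :* (c′ :* n :+ d′ :* m) := (a :* a′ :+ b :* c′) :* n :+ (a :* b′ :+ b :* d′) :* m)
      refl a b a′ b′ c′ d′ (num P) (den P)

  infix 10 _⁻
  -- The adjugate. It inverts the matrix up to the factor det, which homogeneous coordinates do not
  -- see.
  _⁻ : PGL → PGL
  pgl a b c d det ⁻ = pgl d (- b) (- c) a
    (det ∘ trans (solve 4 (λ a b c d → a :* d :+ :- (b :* c) := d :* a :+ :- (:- b :* :- c)) refl a b c d))

  ⁻-inverseˡ : ∀ M P → M ⁻ ⟨$⟩ M ⟨$⟩ P ≡ P
  ⁻-inverseˡ M@(pgl a b c d det≢0) P = coords-unique (⟨$⟩-coords (M ⁻) (⟨$⟩-coords M (coords P)))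
    (coords-≡
      (solve 6 (λ a b c d n m → (a :* d :+ :- (b :* c)) :* n := d :* (a :* n :+ b :* m) :+ :- b :* (c :* n :+ d :* m)) refl a b c d (num P) (den P))
      (solve 6 (λ a b c d n m → (a :* d :+ :- (b :* c)) :* m := :- c :* (a :* n :+ b :* m) :+ a :* (c :* n :+ d :* m)) refl a b c d (num P) (den P))
      (coords-scale (a * d + - (b * c)) det≢0 (coords P)))

  ⁻-inverseʳ : ∀ M P → M ⟨$⟩ M ⁻ ⟨$⟩ P ≡ P
  ⁻-inverseʳ M@(pgl a b c d det≢0) P = coords-unique (⟨$⟩-coords M (⟨$⟩-coords (M ⁻) (coords P)))
    (coords-≡
      (solve 6 (λ a b c d n m → (a :* d :+ :- (b :* c)) :* n := a :* (d :* n :+ :- b :* m) :+ b :* (:- c :* n :+ a :* m)) refl a b c d (num P) (den P))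
      (solve 6 (λ a b c d n m → (a :* d :+ :- (b :* c)) :* m := c :* (d :* n :+ :- b :* m) :+ d :* (:- c :* n :+ a :* m)) refl a b c d (num P) (den P))
      (coords-scale (a * d + - (b * c)) det≢0 (coords P)))

  ⟨$⟩-injective : ∀ M → Injective _≡_ _≡_ (M ⟨$⟩_)
  ⟨$⟩-injective M {P} {Q} eq = trans (sym (⁻-inverseˡ M P)) (trans (cong (M ⁻ ⟨$⟩_) eq) (⁻-inverseˡ M Q))

  ⁻-⟨$⟩ : ∀ M {P Q} → M ⟨$⟩ P ≡ Q → M ⁻ ⟨$⟩ Q ≡ P
  ⁻-⟨$⟩ M {P} refl = ⁻-inverseˡ M P

  minor : X → X → Fin q
  minor P Q = num P * den Q + - (num Q * den P)

  minor≢0 : ∀ P Q → P ≢ Q → minor P Q ≢ 0#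
  minor≢0 ∞ ∞ P≢Q _ = P≢Q refl
  minor≢0 ∞ (suc y) _ eq = 1≢0 (trans (solve 1 (λ y → 1: := 1: :* 1: :+ :- (y :* 0:)) refl y) eq)
  minor≢0 (suc x) ∞ _ eq = 1≢0 (begin
    1#                           ≡⟨ solve 1 (λ x → 1: := :- (x :* 0: :+ :- (1: :* 1:))) refl x ⟩
    - (x * 0# + - (1# * 1#))     ≡⟨ cong -_ eq ⟩
    - 0#                         ≡⟨ solve 0 (:- 0: := 0:) refl ⟩
    0#                           ∎)
  minor≢0 (suc x) (suc y) P≢Q eq = P≢Q (cong suc (x-y≡0⇒x≡y
    (trans (solve 2 (λ x y → x :+ :- y := x :* 1: :+ :- (y :* 1:)) refl x y) eq)))

  𝟘 𝟙 : X
  𝟘 = suc 0#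
  𝟙 = suc 1#

  Sends : PGL → X → X → X → X → X → X → Set
  Sends M P Q R P′ Q′ R′ = (M ⟨$⟩ P ≡ P′) × (M ⟨$⟩ Q ≡ Q′) × (M ⟨$⟩ R ≡ R′)

  -- The columns of the matrix are multiples of coordinates of P and Q, chosen by Cramer's rule
  -- so that their sum is a multiple of coordinates of R.
  frame : ∀ P Q R → P ≢ Q → P ≢ R → Q ≢ R → ∃ λ M → Sends M ∞ 𝟘 𝟙 P Q R
  frame P Q R P≢Q P≢R Q≢R = M ,
    coords-unique (⟨$⟩-coords M (coords ∞)) (coords-≡ (first α (num P) β (num Q)) (first α (den P) β (den Q)) (coords-scale α α≢0 (coords P))) ,
    coords-unique (⟨$⟩-coords M (coords 𝟘)) (coords-≡ (second α (num P) β (num Q)) (second α (den P) β (den Q)) (coords-scale β β≢0 (coords Q))) ,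
    coords-unique (⟨$⟩-coords M (coords 𝟙)) (coords-≡
      (solve 6 (λ p p′ q q′ r r′ → (p :* q′ :+ :- (q :* p′)) :* r := (r :* q′ :+ :- (q :* r′)) :* p :* 1: :+ (p :* r′ :+ :- (r :* p′)) :* q :* 1:)
        refl (num P) (den P) (num Q) (den Q) (num R) (den R))
      (solve 6 (λ p p′ q q′ r r′ → (p :* q′ :+ :- (q :* p′)) :* r′ := (r :* q′ :+ :- (q :* r′)) :* p′ :* 1: :+ (p :* r′ :+ :- (r :* p′)) :* q′ :* 1:)
        refl (num P) (den P) (num Q) (den Q) (num R) (den R))
      (coords-scale (minor P Q) (minor≢0 P Q P≢Q) (coords R)))
    where
    α = minor R Q
    β = minor P R
    α≢0 = minor≢0 R Q (Q≢R ∘ sym)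
    β≢0 = minor≢0 P R P≢R
    M : PGL
    M = pgl (α * num P) (β * num Q) (α * den P) (β * den Q)
      (xy≢0 (xy≢0 α≢0 β≢0) (minor≢0 P Q P≢Q) ∘ trans
        (solve 6 (λ α β p p′ q q′ → α :* β :* (p :* q′ :+ :- (q :* p′)) := α :* p :* (β :* q′) :+ :- (β :* q :* (α :* p′)))
          refl α β (num P) (den P) (num Q) (den Q)))
    first : ∀ α p β q → α * p ≡ α * p * 1# + β * q * 0#
    first = solve 4 (λ α p β q → α :* p := α :* p :* 1: :+ β :* q :* 0:) refl
    second : ∀ α p β q → β * q ≡ α * p * 0# + β * q * 1#
    second = solve 4 (λ α p β q → β :* q := α :* p :* 0: :+ β :* q :* 1:) refl

  -- Fixing `∞`, `𝟘` and `𝟙` forces c = 0, b = 0 and a = d in turn, so the matrix is scalar.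
  fixes-frame⇒id : ∀ M → Sends M ∞ 𝟘 𝟙 ∞ 𝟘 𝟙 → ∀ P → M ⟨$⟩ P ≡ P
  fixes-frame⇒id M@(pgl a b c d det≢0) (M∞ , M0 , M1) P =
    coords-unique (⟨$⟩-coords M (coords P)) (coords-≡
      (trans (solve 3 (λ a n m → a :* n := a :* n :+ 0: :* m) refl a (num P) (den P)) (cong (λ z → a * num P + z * den P) (sym b≡0)))
      (trans (solve 3 (λ a n m → a :* m := 0: :* n :+ a :* m) refl a (num P) (den P)) (cong₂ (λ y z → y * num P + z * den P) (sym c≡0) a≡d))
      (coords-scale a a≢0 (coords P)))
    where
    c≡0 : c ≡ 0#
    c≡0 with coordinates s _ _ eq ← subst (λ Q → Coords Q _ _) M∞ (⟨$⟩-coords M (coords ∞)) =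
      trans (solve 2 (λ c d → c := c :* 1: :+ d :* 0:) refl c d) (trans eq (zeroʳ s))
    b≡0 : b ≡ 0#
    b≡0 with _ , eq ← coords-suc (subst (λ Q → Coords Q _ _) M0 (⟨$⟩-coords M (coords 𝟘))) =
      trans (solve 2 (λ a b → b := a :* 0: :+ b :* 1:) refl a b) (trans eq (zeroʳ _))
    a≡d : a ≡ d
    a≡d with _ , eq ← coords-suc (subst (λ Q → Coords Q _ _) M1 (⟨$⟩-coords M (coords 𝟙))) = begin
      a                       ≡⟨ solve 1 (λ a → a := a :* 1: :+ 0: :* 1:) refl a ⟩
      a * 1# + 0# * 1#        ≡⟨ cong (λ z → a * 1# + z * 1#) b≡0 ⟨
      a * 1# + b * 1#         ≡⟨ eq ⟩
      (c * 1# + d * 1#) * 1#  ≡⟨ cong (λ z → (z * 1# + d * 1#) * 1#) c≡0 ⟩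
      (0# * 1# + d * 1#) * 1# ≡⟨ solve 1 (λ d → (0: :* 1: :+ d :* 1:) :* 1: := d) refl d ⟩
      d                       ∎
    a≢0 : a ≢ 0#
    a≢0 a≡0 = det≢0 (trans (cong₂ (λ y z → y * d + - (z * c)) a≡0 b≡0) (solve 2 (λ c d → 0: :* d :+ :- (0: :* c) := 0:) refl c d))

  transitive : ∀ {P Q R P′ Q′ R′} → P ≢ Q → P ≢ R → Q ≢ R → P′ ≢ Q′ → P′ ≢ R′ → Q′ ≢ R′ →
               ∃ λ M → Sends M P Q R P′ Q′ R′
  transitive {P} {Q} {R} {P′} {Q′} {R′} P≢Q P≢R Q≢R P′≢Q′ P′≢R′ Q′≢R′ =
    compose (frame P Q R P≢Q P≢R Q≢R) (frame P′ Q′ R′ P′≢Q′ P′≢R′ Q′≢R′)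
    where
    image : ∀ N N′ S {T T′} → N ⟨$⟩ S ≡ T → N′ ⟨$⟩ S ≡ T′ → N′ ⊙ N ⁻ ⟨$⟩ T ≡ T′
    image N N′ S {T} e e′ = trans (⊙-⟨$⟩ N′ (N ⁻) T) (trans (cong (N′ ⟨$⟩_) (⁻-⟨$⟩ N e)) e′)
    compose : (∃ λ N → Sends N ∞ 𝟘 𝟙 P Q R) → (∃ λ N′ → Sends N′ ∞ 𝟘 𝟙 P′ Q′ R′) → ∃ λ M → Sends M P Q R P′ Q′ R′
    compose (N , N∞ , N0 , N1) (N′ , N′∞ , N′0 , N′1) =
      N′ ⊙ N ⁻ , image N N′ ∞ N∞ N′∞ , image N N′ 𝟘 N0 N′0 , image N N′ 𝟙 N1 N′1

  -- Conjugation by the map from `frame` reduces to the points `∞`, `𝟘`, `𝟙`.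
  fixes-three⇒id : ∀ {P Q R} → P ≢ Q → P ≢ R → Q ≢ R → ∀ M → Sends M P Q R P Q R → ∀ S → M ⟨$⟩ S ≡ S
  fixes-three⇒id {P} {Q} {R} P≢Q P≢R Q≢R M (MP , MQ , MR) S = conjugate (frame P Q R P≢Q P≢R Q≢R)
    where
    conjugate : (∃ λ N → Sends N ∞ 𝟘 𝟙 P Q R) → M ⟨$⟩ S ≡ S
    conjugate (N , N∞ , N0 , N1) = begin
      M ⟨$⟩ S                             ≡⟨ cong (M ⟨$⟩_) (⁻-inverseʳ N S) ⟨
      M ⟨$⟩ N ⟨$⟩ T                       ≡⟨ ⁻-inverseʳ N _ ⟨
      N ⟨$⟩ N ⁻ ⟨$⟩ M ⟨$⟩ N ⟨$⟩ T         ≡⟨ cong (N ⟨$⟩_) (K-⟨$⟩ T) ⟨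
      N ⟨$⟩ K ⟨$⟩ T                       ≡⟨ cong (N ⟨$⟩_) (fixes-frame⇒id K (fixes ∞ N∞ MP , fixes 𝟘 N0 MQ , fixes 𝟙 N1 MR) T) ⟩
      N ⟨$⟩ T                             ≡⟨ ⁻-inverseʳ N S ⟩
      S                                   ∎
      where
      K = N ⁻ ⊙ M ⊙ N
      T = N ⁻ ⟨$⟩ S
      K-⟨$⟩ : ∀ T → K ⟨$⟩ T ≡ N ⁻ ⟨$⟩ M ⟨$⟩ N ⟨$⟩ T
      K-⟨$⟩ T = trans (⊙-⟨$⟩ (N ⁻) (M ⊙ N) T) (cong (N ⁻ ⟨$⟩_) (⊙-⟨$⟩ M N T))
      fixes : ∀ S {T} → N ⟨$⟩ S ≡ T → M ⟨$⟩ T ≡ T → K ⟨$⟩ S ≡ S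
      fixes S e e′ = trans (K-⟨$⟩ S) (trans (cong (λ U → N ⁻ ⟨$⟩ M ⟨$⟩ U) e) (trans (cong (N ⁻ ⟨$⟩_) e′) (⁻-⟨$⟩ N e)))

-- The order of a primitive element.

module PrimitiveElement {q : ℕ} (F : FiniteFieldOn q) (θ : Fin q) (θ-primitive : FiniteFieldOn.IsPrimitive F θ) where
  open Field F

  ^≡^⇒^∸≡1 : ∀ {x} → x ≢ 0# → ∀ {i j} → i ℕ.≤ j → x ^ i ≡ x ^ j → x ^ (j ℕ.∸ i) ≡ 1#
  ^≡^⇒^∸≡1 {x} x≢0 {i} {j} i≤j eq = *-cancelˡ (x^n≢0 i x≢0) (begin
    x ^ i * x ^ (j ℕ.∸ i)   ≡⟨ ^-+ x i (j ℕ.∸ i) ⟨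
    x ^ (i ℕ.+ (j ℕ.∸ i))   ≡⟨ cong (x ^_) (ℕ.m+[n∸m]≡n i≤j) ⟩
    x ^ j                   ≡⟨ eq ⟨
    x ^ i                   ≡⟨ *-identityʳ _ ⟨
    x ^ i * 1#              ∎)
    where open ≡-Reasoning

  ^-% : ∀ {x m} .{{_ : ℕ.NonZero m}} → x ^ m ≡ 1# → ∀ i → x ^ i ≡ x ^ (i % m)
  ^-% {x} {m} x^m≡1 i = begin
    x ^ i                                  ≡⟨ cong (x ^_) (m≡m%n+[m/n]*n i m) ⟩
    x ^ (i % m ℕ.+ (i / m) ℕ.* m)          ≡⟨ ^-+ x (i % m) _ ⟩
    x ^ (i % m) * x ^ ((i / m) ℕ.* m)      ≡⟨ cong (x ^ (i % m) *_) (^-* x (i / m) m) ⟩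
    x ^ (i % m) * (x ^ m) ^ (i / m)        ≡⟨ cong (λ z → x ^ (i % m) * z ^ (i / m)) x^m≡1 ⟩
    x ^ (i % m) * 1# ^ (i / m)             ≡⟨ cong (x ^ (i % m) *_) (1^n≡1 (i / m)) ⟩
    x ^ (i % m) * 1#                       ≡⟨ *-identityʳ _ ⟩
    x ^ (i % m)                            ∎
    where open ≡-Reasoning

  θ≢0 : θ ≢ 0#
  θ≢0 = proj₁ θ-primitive

  log : ∀ x → x ≢ 0# → ∃ λ i → θ ^ i ≡ x
  log = proj₂ θ-primitive

  -- If θᵐ = 1, a logarithm matters only modulo m. Logarithms modulo m, with one extra value for 0,
  -- embed the field into 1 + m values.
  θ^m≡1⇒q≤1+m : ∀ m .{{_ : ℕ.NonZero m}} → θ ^ m ≡ 1# → q ℕ.≤ suc m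
  θ^m≡1⇒q≤1+m m θ^m≡1 = Fin.injective⇒≤ {f = f} f-injective
    where
    f : Fin q → Fin (suc m)
    f x with x ≟ 0#
    ... | yes _   = zero
    ... | no  x≢0 = suc (fromℕ< (m%n<n (proj₁ (log x x≢0)) m))
    f-injective : Injective _≡_ _≡_ f
    f-injective {x} {y} eq with x ≟ 0# | y ≟ 0#
    ... | yes x≡0 | yes y≡0 = trans x≡0 (sym y≡0)
    ... | no  x≢0 | no  y≢0 = begin
      x             ≡⟨ proj₂ (log x x≢0) ⟨
      θ ^ i         ≡⟨ ^-% θ^m≡1 i ⟩
      θ ^ (i % m)   ≡⟨ cong (θ ^_) (Fin.fromℕ<-injective (i % m) (j % m) (m%n<n i m) (m%n<n j m) (Fin.suc-injective eq)) ⟩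
      θ ^ (j % m)   ≡⟨ ^-% θ^m≡1 j ⟨
      θ ^ j         ≡⟨ proj₂ (log y y≢0) ⟩
      y             ∎
      where
      open ≡-Reasoning
      i = proj₁ (log x x≢0)
      j = proj₁ (log y y≢0)

  module _ (n : ℕ) .{{_ : ℕ.NonZero n}} (q≡1+n : q ≡ suc n) where

    -- Among 0 and θ⁰, ..., θⁿ there are q + 1 entries, so two coincide, and neither can be 0. The
    -- difference m of the two exponents is at most n and satisfies θᵐ = 1; the preceding bound
    -- gives m ≥ n.
    θ^n≡1 : θ ^ n ≡ 1#
    θ^n≡1 with Fin.pigeonhole (ℕ.n<1+n q) powers
      where
      powers : Fin (suc q) → Fin q
      powers zero    = 0#
      powers (suc i) = θ ^ toℕ i
    ... | zero  , suc j , _         , eq = contradiction (sym eq) (x^n≢0 (toℕ j) θ≢0)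
    ... | suc i , suc j , ℕ.s≤s i<j , eq = subst (λ m → θ ^ m ≡ 1#) (ℕ.≤-antisym m≤n n≤m) θ^m≡1
      where
      m = toℕ j ℕ.∸ toℕ i
      θ^m≡1 : θ ^ m ≡ 1#
      θ^m≡1 = ^≡^⇒^∸≡1 θ≢0 (ℕ.<⇒≤ i<j) eq
      n≤m : n ℕ.≤ m
      n≤m = ℕ.s≤s⁻¹ (subst (ℕ._≤ suc m) q≡1+n (θ^m≡1⇒q≤1+m m {{ℕ.>-nonZero (ℕ.m<n⇒0<n∸m i<j)}} θ^m≡1))
      m≤n : m ℕ.≤ n
      m≤n = ℕ.≤-trans (ℕ.m∸n≤m (toℕ j) (toℕ i)) (ℕ.s≤s⁻¹ (subst (toℕ j ℕ.<_) q≡1+n (Fin.toℕ<n j)))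

    θ^i≡1⇒n∣i : ∀ i → θ ^ i ≡ 1# → n ∣ i
    θ^i≡1⇒n∣i i θ^i≡1 with i % n in eq
    ... | zero  = m%n≡0⇒n∣m i n eq
    ... | suc m = contradiction n≤1+m (ℕ.<⇒≱ (subst (ℕ._< n) eq (m%n<n i n)))
      where
      n≤1+m : n ℕ.≤ suc m
      n≤1+m = ℕ.s≤s⁻¹ (subst (ℕ._≤ suc (suc m)) q≡1+n
        (θ^m≡1⇒q≤1+m (suc m) (trans (cong (θ ^_) (sym eq)) (trans (sym (^-% θ^n≡1 i)) θ^i≡1))))

-- The base block B.

module BaseBlock {q : ℕ} (F : FiniteFieldOn q) (θ : Fin q) (θ-primitive : FiniteFieldOn.IsPrimitive F θ)
                 (k r : ℕ) .{{_ : ℕ.NonZero k}} .{{_ : ℕ.NonZero r}} (q≡1+kr : q ≡ suc (k ℕ.* r)) where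
  open Field F
  open PrimitiveElement F θ θ-primitive
  open ProjectiveLine F
  open ≡-Reasoning

  private instance
    kr≢0 : ℕ.NonZero (k ℕ.* r)
    kr≢0 = ℕ.m*n≢0 k r

  ω : Fin q
  ω = θ ^ r

  ω≢0 : ω ≢ 0#
  ω≢0 = x^n≢0 r θ≢0

  ω^k≡1 : ω ^ k ≡ 1#
  ω^k≡1 = trans (sym (^-* θ k r)) (θ^n≡1 (k ℕ.* r) q≡1+kr)

  ω^i-root : ∀ i → (ω ^ i) ^ k ≡ 1#
  ω^i-root i = begin
    (ω ^ i) ^ k     ≡⟨ ^-* ω k i ⟨
    ω ^ (k ℕ.* i)   ≡⟨ cong (ω ^_) (ℕ.*-comm k i) ⟩
    ω ^ (i ℕ.* k)   ≡⟨ ^-* ω i k ⟩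
    (ω ^ k) ^ i     ≡⟨ cong (_^ i) ω^k≡1 ⟩
    1# ^ i          ≡⟨ 1^n≡1 i ⟩
    1#              ∎

  x^k≡1⇒x≢0 : ∀ {x} → x ^ k ≡ 1# → x ≢ 0#
  x^k≡1⇒x≢0 x^k≡1 refl = 0≢1 (trans (sym (0^ k)) x^k≡1)
    where
    0^ : ∀ n .{{_ : ℕ.NonZero n}} → 0# ^ n ≡ 0#
    0^ (suc n) = zeroˡ _

  -- For x = θⁱ the hypothesis gives kr ∣ ki, hence r ∣ i.
  root⇒ω^i : ∀ x → x ^ k ≡ 1# → ∃ λ i → x ≡ ω ^ i
  root⇒ω^i x x^k≡1 with log x (x^k≡1⇒x≢0 x^k≡1)
  ... | i , refl with *-cancelˡ-∣ k (θ^i≡1⇒n∣i (k ℕ.* r) q≡1+kr (k ℕ.* i) (trans (^-* θ k i) x^k≡1))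
  ...   | divides j refl = j , ^-* θ j r

  ω^i≢ω^j : ∀ {i j} → i ℕ.< j → j ℕ.< k → ω ^ i ≢ ω ^ j
  ω^i≢ω^j {i} {j} i<j j<k eq = ℕ.<⇒≱ j<k (ℕ.≤-trans k≤j∸i (ℕ.m∸n≤m j i))
    where
    instance _ = ℕ.>-nonZero (ℕ.m<n⇒0<n∸m i<j)
    k≤j∸i : k ℕ.≤ j ℕ.∸ i
    k≤j∸i = ∣⇒≤ (*-cancelʳ-∣ r (θ^i≡1⇒n∣i (k ℕ.* r) q≡1+kr ((j ℕ.∸ i) ℕ.* r)
      (trans (^-* θ (j ℕ.∸ i) r) (^≡^⇒^∸≡1 ω≢0 (ℕ.<⇒≤ i<j) eq))))

  ω^-injective : ∀ {i j} → i ℕ.< k → j ℕ.< k → ω ^ i ≡ ω ^ j → i ≡ j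
  ω^-injective {i} {j} i<k j<k eq with ℕ.<-cmp i j
  ... | tri< i<j _ _ = contradiction eq (ω^i≢ω^j i<j j<k)
  ... | tri≈ _ i≡j _ = i≡j
  ... | tri> _ _ j<i = contradiction (sym eq) (ω^i≢ω^j j<i i<k)

  -- The set `InB` described by the equations x = 0 or xᵏ = 1, which are decidable and can enter
  -- computations; `InB⇔ℬ` links the two.
  ℬ : X → Set
  ℬ ∞       = ⊥
  ℬ (suc x) = x ≡ 0# ⊎ x ^ k ≡ 1#

  ℬ? : ∀ P → Dec (ℬ P)
  ℬ? ∞       = no λ ()
  ℬ? (suc x) = (x ≟ 0#) ⊎-dec (x ^ k ≟ 1#)

  InB⇔ℬ : ∀ P → InB θ r P ⇔ ℬ P
  InB⇔ℬ ∞       = mk⇔ (λ x → x) (λ x → x)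
  InB⇔ℬ (suc x) = mk⇔
    (λ { (inj₁ x≡0) → inj₁ x≡0 ; (inj₂ (i , refl)) → inj₂ (ω^i-root i) })
    (λ { (inj₁ x≡0) → inj₁ x≡0 ; (inj₂ x^k≡1) → inj₂ (root⇒ω^i x x^k≡1) })

  element : Fin (suc k) → Fin q
  element zero    = 0#
  element (suc i) = ω ^ toℕ i

  β : Fin (suc k) → X
  β i = suc (element i)

  β∈ℬ : ∀ i → ℬ (β i)
  β∈ℬ zero    = inj₁ refl
  β∈ℬ (suc i) = inj₂ (ω^i-root (toℕ i))

  β-injective : Injective _≡_ _≡_ β
  β-injective {zero}  {zero}  eq = refl
  β-injective {zero}  {suc j} eq = contradiction (sym (Fin.suc-injective eq)) (x^n≢0 (toℕ j) ω≢0)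
  β-injective {suc i} {zero}  eq = contradiction (Fin.suc-injective eq) (x^n≢0 (toℕ i) ω≢0)
  β-injective {suc i} {suc j} eq =
    cong suc (Fin.toℕ-injective (ω^-injective (Fin.toℕ<n i) (Fin.toℕ<n j) (Fin.suc-injective eq)))

  β-surjective : ∀ P → ℬ P → ∃ λ i → β i ≡ P
  β-surjective (suc x) (inj₁ refl)  = zero , refl
  β-surjective (suc x) (inj₂ x^k≡1) with root⇒ω^i x x^k≡1
  ... | i , refl = suc (fromℕ< (m%n<n i k)) ,
    cong suc (trans (cong (ω ^_) (Fin.toℕ-fromℕ< (m%n<n i k))) (sym (^-% ω^k≡1 i)))

  -- In the field 1 + kr = q = 0, so k = 0 would give 1 = 0.
  ιk≢0 : ι k ≢ 0#
  ιk≢0 ιk≡0 = 1≢0 (begin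
    1#                  ≡⟨ solve 1 (λ r → 1: := 1: :+ 0: :* r) refl (ι r) ⟩
    1# + 0# * ι r       ≡⟨ cong (λ z → 1# + z * ι r) ιk≡0 ⟨
    1# + ι k * ι r      ≡⟨ cong (1# +_) (×1-homo-* k r) ⟨
    1# + ι (k ℕ.* r)    ≡⟨ ι-suc (k ℕ.* r) ⟨
    ι (suc (k ℕ.* r))   ≡⟨ cong ι q≡1+kr ⟨
    ι q                 ≡⟨ ιq≡0 ⟩
    0#                  ∎)

-- Elimination in the equations for a map exchanging 0 and 1.

module BinomialEquations {q : ℕ} (F : FiniteFieldOn q) where
  open Field F
  open Polynomials F
  open ≡-Reasoning

  -- Here and in the next two lemmas `G` is a linear combination of differences of equal quantities.
  -- The cofactors `u`, `u′`, `u″` are an explicit certificate, which the solver checks as a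
  -- polynomial identity.
  combine₁ : ∀ {G x y} u → x ≡ y → G ≡ u * (x + - y) → G ≡ 0#
  combine₁ {G} {x} u refl eq = trans eq (solve 2 (λ u x → u :* (x :+ :- x) := 0:) refl u x)

  combine₂ : ∀ {G x y x′ y′} u u′ → x ≡ y → x′ ≡ y′ → G ≡ u * (x + - y) + u′ * (x′ + - y′) → G ≡ 0#
  combine₂ {G} {x} {x′ = x′} u u′ refl refl eq =
    trans eq (solve 4 (λ u x u′ x′ → u :* (x :+ :- x) :+ u′ :* (x′ :+ :- x′) := 0:) refl u x u′ x′)

  combine₃ : ∀ {G x y x′ y′ x″ y″} u u′ u″ → x ≡ y → x′ ≡ y′ → x″ ≡ y″ →
             G ≡ u * (x + - y) + u′ * (x′ + - y′) + u″ * (x″ + - y″) → G ≡ 0#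
  combine₃ {G} {x} {x′ = x′} {x″ = x″} u u′ u″ refl refl refl eq =
    trans eq (solve 6 (λ u x u′ x′ u″ x″ → u :* (x :+ :- x) :+ u′ :* (x′ :+ :- x′) :+ u″ :* (x″ :+ :- x″) := 0:) refl u x u′ x′ u″ x″)

  ι-C-step : ∀ n i → ι (suc i) * ι (n C suc i) + ι i * ι (n C i) ≡ ι n * ι (n C i)
  ι-C-step n i = begin
    ι (suc i) * ι (n C suc i) + ι i * ι (n C i)              ≡⟨ cong₂ _+_ (×1-homo-* (suc i) (n C suc i)) (×1-homo-* i (n C i)) ⟨
    ι (suc i ℕ.* (n C suc i)) + ι (i ℕ.* (n C i))            ≡⟨ ×-homo-+ 1# (suc i ℕ.* (n C suc i)) (i ℕ.* (n C i)) ⟨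
    ι (suc i ℕ.* (n C suc i) ℕ.+ i ℕ.* (n C i))              ≡⟨ cong ι (C-step n i) ⟩
    ι (n ℕ.* (n C i))                                        ≡⟨ ×1-homo-* n (n C i) ⟩
    ι n * ι (n C i)                                          ∎

  2≡0⇒ι∈𝔽₂ : 1# + 1# ≡ 0# → ∀ n → ι n ≡ 0# ⊎ ι n ≡ 1#
  2≡0⇒ι∈𝔽₂ 2≡0 zero    = inj₁ refl
  2≡0⇒ι∈𝔽₂ 2≡0 (suc n) with 2≡0⇒ι∈𝔽₂ 2≡0 n
  ... | inj₁ eq = inj₂ (trans (ι-suc n) (trans (cong (1# +_) eq) (+-identityʳ 1#)))
  ... | inj₂ eq = inj₁ (trans (ι-suc n) (trans (cong (1# +_) eq) 2≡0))

  -- The coefficient of xⁱ in (1 + c x)ᵏ − (1 − x)ᵏ.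
  swapCoeff : ℕ → Fin q → ℕ → Fin q
  swapCoeff k c i = binomialCoeff k c i + - 1# * binomialCoeff k (- 1#) i

  -- The equations for i ≤ 4 read K = b₂ (c − 1) = b₃ (c² − c + 1) = b₄ (c − 1) (c² + 1) after division by c + 1,
  -- where K = k and bᵢ are binomial coefficients. If 2 ≠ 0, eliminating c from the first two gives
  -- K (K − 3) (K + 1) = 0; the third one excludes K = 3, and K = −1 forces c = 0.
  swapCoeffs≡⇒c≡0 : ∀ k c → ι k ≢ 0# → c + 1# ≢ 0# →
    swapCoeff k c 2 ≡ swapCoeff k c 1 → swapCoeff k c 3 ≡ swapCoeff k c 1 → swapCoeff k c 4 ≡ swapCoeff k c 1 → c ≡ 0#
  swapCoeffs≡⇒c≡0 k c K≢0 c+1≢0 e₂ e₃ e₄ = c≡0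
    where
    K  = ι k
    b₁ = ι (k C 1)
    b₂ = ι (k C 2)
    b₃ = ι (k C 3)
    b₄ = ι (k C 4)

    b₁≡K : b₁ ≡ K
    b₁≡K = cong ι (nC1≡n k)

    C₂ : (1# + 1#) * b₂ + 1# * K ≡ K * K
    C₂ = subst (λ b → (1# + 1#) * b₂ + 1# * b ≡ K * b) b₁≡K (ι-C-step k 1)

    C₃ : (1# + 1# + 1#) * b₃ + (1# + 1#) * b₂ ≡ K * b₂
    C₃ = ι-C-step k 2

    C₄ : (1# + 1# + 1# + 1#) * b₄ + (1# + 1# + 1#) * b₃ ≡ K * b₃
    C₄ = ι-C-step k 3

    -- The i-th coefficient is bᵢ (cⁱ - (-1)ⁱ), which always contains the factor c + 1; for i = 1
    -- the cofactor is just b₁ = K.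
    A₁ : swapCoeff k c 1 ≡ (c + 1#) * K
    A₁ = trans (solve 2 (λ b c → b :* (c :* 1:) :+ :- 1: :* (b :* (:- 1: :* 1:)) := (c :+ 1:) :* b) refl b₁ c)
               (cong ((c + 1#) *_) b₁≡K)

    h₂ : b₂ * (c + - 1#) ≡ K
    h₂ = *-cancelˡ c+1≢0 (trans
      (solve 2 (λ b c → (c :+ 1:) :* (b :* (c :+ :- 1:)) := b :* (c :* (c :* 1:)) :+ :- 1: :* (b :* (:- 1: :* (:- 1: :* 1:)))) refl b₂ c)
      (trans e₂ A₁))

    h₃ : b₃ * (c * c + - c + 1#) ≡ K
    h₃ = *-cancelˡ c+1≢0 (trans
      (solve 2 (λ b c → (c :+ 1:) :* (b :* (c :* c :+ :- c :+ 1:))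
         := b :* (c :* (c :* (c :* 1:))) :+ :- 1: :* (b :* (:- 1: :* (:- 1: :* (:- 1: :* 1:))))) refl b₃ c)
      (trans e₃ A₁))

    h₄ : b₄ * ((c + - 1#) * (c * c + 1#)) ≡ K
    h₄ = *-cancelˡ c+1≢0 (trans
      (solve 2 (λ b c → (c :+ 1:) :* (b :* ((c :+ :- 1:) :* (c :* c :+ 1:)))
         := b :* (c :* (c :* (c :* (c :* 1:)))) :+ :- 1: :* (b :* (:- 1: :* (:- 1: :* (:- 1: :* (:- 1: :* 1:)))))) refl b₄ c)
      (trans e₄ A₁))

    -- In characteristic 2, K and b₂ are 0 or 1. Here K ≠ 0, and b₂ = 0 contradicts `h₂`; with K =
    -- b₂ = 1, `h₂` reads c - 1 = 1, so c = 2 = 0.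
    char2 : 1# + 1# ≡ 0# → c ≡ 0#
    char2 2≡0 with 2≡0⇒ι∈𝔽₂ 2≡0 k | 2≡0⇒ι∈𝔽₂ 2≡0 (k C 2)
    ... | inj₁ K≡0 | _          = contradiction K≡0 K≢0
    ... | inj₂ K≡1 | inj₁ b₂≡0  = contradiction (trans (sym h₂) (trans (cong (_* (c + - 1#)) b₂≡0) (zeroˡ _))) K≢0
    ... | inj₂ K≡1 | inj₂ b₂≡1  = combine₂ 1# 1# (trans (sym (cong (_* (c + - 1#)) b₂≡1)) (trans h₂ K≡1)) 2≡0
          (solve 1 (λ c → c := 1: :* (1: :* (c :+ :- 1:) :+ :- 1:) :+ 1: :* (1: :+ 1: :+ :- 0:)) refl c)

    module _ (2≢0 : 1# + 1# ≢ 0#) where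

      -- Twice `h₂`, with 2 b₂ = K (K - 1) from `C₂`, and K cancelled.
      σ : (K + - 1#) * (c + - 1#) ≡ 1# + 1#
      σ = x-y≡0⇒x≡y (xy≡0⇒y≡0 K≢0 (combine₂ (- (c + - 1#)) (1# + 1#) C₂ h₂
        (solve 3 (λ K b c → K :* ((K :+ :- 1:) :* (c :+ :- 1:) :+ :- (1: :+ 1:))
           := :- (c :+ :- 1:) :* ((1: :+ 1:) :* b :+ 1: :* K :+ :- (K :* K)) :+ (1: :+ 1:) :* (b :* (c :+ :- 1:) :+ :- K)) refl K b₂ c)))

      six = 1# + 1# + 1# + 1# + 1# + 1#

      -- Six times `h₃`, with 6 b₃ = K (K - 1)(K - 2) from `C₂` and `C₃`, and K cancelled.
      τ : (K + - 1#) * (K + - (1# + 1#)) * (c * c + - c + 1#) ≡ six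
      τ = x-y≡0⇒x≡y (xy≡0⇒y≡0 K≢0 (combine₃ six (- (1# + 1#) * (c * c + - c + 1#)) (- ((c * c + - c + 1#) * (K + - (1# + 1#)))) h₃ C₃ C₂
        (solve 4 (λ K b₂ b₃ c →
          K :* ((K :+ :- 1:) :* (K :+ :- (1: :+ 1:)) :* (c :* c :+ :- c :+ 1:) :+ :- (1: :+ 1: :+ 1: :+ 1: :+ 1: :+ 1:))
          := (1: :+ 1: :+ 1: :+ 1: :+ 1: :+ 1:) :* (b₃ :* (c :* c :+ :- c :+ 1:) :+ :- K)
             :+ :- (1: :+ 1:) :* (c :* c :+ :- c :+ 1:) :* ((1: :+ 1: :+ 1:) :* b₃ :+ (1: :+ 1:) :* b₂ :+ :- (K :* b₂))
             :+ :- ((c :* c :+ :- c :+ 1:) :* (K :+ :- (1: :+ 1:))) :* ((1: :+ 1:) :* b₂ :+ 1: :* K :+ :- (K :* K))) refl K b₂ b₃ c)))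

      -- By `σ`, (K - 1)² (c² - c + 1) = 4 + 2 (K - 1) + (K - 1)² = K² + 3. So K - 1 times `τ`
      -- becomes (K - 2)(K² + 3) = 6 (K - 1), that is, K³ - 2K² - 3K = 0.
      eliminant : K * ((K + - (1# + 1# + 1#)) * (K + 1#)) ≡ 0#
      eliminant = combine₂ (K + - 1#) (- ((K + - (1# + 1#)) * (K + 1# + 1# + 1# + ((K + - 1#) * (c + - 1#) + - (1# + 1#))))) τ σ
        (solve 2 (λ K c → K :* ((K :+ :- (1: :+ 1: :+ 1:)) :* (K :+ 1:))
          := (K :+ :- 1:) :* ((K :+ :- 1:) :* (K :+ :- (1: :+ 1:)) :* (c :* c :+ :- c :+ 1:) :+ :- (1: :+ 1: :+ 1: :+ 1: :+ 1: :+ 1:))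
             :+ :- ((K :+ :- (1: :+ 1:)) :* (K :+ 1: :+ 1: :+ 1: :+ ((K :+ :- 1:) :* (c :+ :- 1:) :+ :- (1: :+ 1:))))
                :* ((K :+ :- 1:) :* (c :+ :- 1:) :+ :- (1: :+ 1:))) refl K c)

      K≢3 : K + - (1# + 1# + 1#) ≢ 0#
      K≢3 K-3≡0 = K≢0 (trans (sym h₄) (trans (cong (_* ((c + - 1#) * (c * c + 1#))) b₄≡0) (zeroˡ _)))
        where
        -- `C₄` says 4 b₄ = (K - 3) b₃, and 4 is invertible here.
        b₄≡0 : b₄ ≡ 0#
        b₄≡0 = xy≡0⇒y≡0 (xy≢0 2≢0 2≢0) (combine₂ 1# b₃ C₄ K-3≡0
          (solve 3 (λ K b₃ b₄ → (1: :+ 1:) :* (1: :+ 1:) :* b₄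
            := 1: :* ((1: :+ 1: :+ 1: :+ 1:) :* b₄ :+ (1: :+ 1: :+ 1:) :* b₃ :+ :- (K :* b₃)) :+ b₃ :* (K :+ :- (1: :+ 1: :+ 1:) :+ :- 0:)) refl K b₃ b₄))

      odd : c ≡ 0#
      odd = xy≡0⇒y≡0 K-1≢0 (combine₂ 1# 1# σ K+1≡0
        (solve 2 (λ K c → (K :+ :- 1:) :* c := 1: :* ((K :+ :- 1:) :* (c :+ :- 1:) :+ :- (1: :+ 1:)) :+ 1: :* (K :+ 1: :+ :- 0:)) refl K c))
        where
        K+1≡0 : K + 1# ≡ 0#
        K+1≡0 = xy≡0⇒y≡0 K≢3 (xy≡0⇒y≡0 K≢0 eliminant)
        K-1≢0 : K + - 1# ≢ 0#
        K-1≢0 K-1≡0 = 2≢0 (combine₂ 1# (- 1#) K+1≡0 K-1≡0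
          (solve 1 (λ K → 1: :+ 1: := 1: :* (K :+ 1: :+ :- 0:) :+ :- 1: :* (K :+ :- 1: :+ :- 0:)) refl K))

    c≡0 : c ≡ 0#
    c≡0 with 1# + 1# ≟ 0#
    ... | yes 2≡0 = char2 2≡0
    ... | no  2≢0 = odd 2≢0

-- Lagrange's theorem for additive subgroups.

module AdditiveSubgroup {q : ℕ} (F : FiniteFieldOn q) where
  open Field F

  lagrange : ∀ {m} (f : Fin (suc m) → Fin q) → Injective _≡_ _≡_ f → (∀ i j → ∃ λ l → f l ≡ f i + - f j) → suc m ∣ q
  lagrange {m} f f-injective closed = subst (suc m ∣_) (∣⊤∣≡n q) (union-of-cosets q ⊤ (∣p∣≤n ⊤) (λ _ _ _ → ∈⊤))
    where
    +-cancelˡ : ∀ x {y z} → x + y ≡ x + z → y ≡ z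
    +-cancelˡ x {y} {z} eq = x-y≡0⇒x≡y (trans
      (solve 3 (λ x y z → y :+ :- z := (x :+ y) :+ :- (x :+ z)) refl x y z) (x≡y⇒x-y≡0 eq))

    -- A set closed under adding the `f i` loses the coset of one of its elements and stays closed.
    -- The induction is on a bound for the cardinality, which drops by suc m at each step.
    union-of-cosets : ∀ n (S : Subset q) → ∣ S ∣ ℕ.≤ n → (∀ x i → x ∈ S → x + f i ∈ S) → suc m ∣ ∣ S ∣
    union-of-cosets n S ∣S∣≤n S-closed with ∣ S ∣ in eq
    ... | zero = suc m ∣0
    ... | suc s with n | ∣p∣≡1+m⇒nonempty S eq
    ...   | suc n | x , x∈S , _ = subst (suc m ∣_) (trans (sym card) eq) (∣m∣n⇒∣m+n ∣-refl (union-of-cosets n S′ ∣S′∣≤n S′-closed))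
      where
      removed = remove-image S (λ i → x + f i) (f-injective ∘ +-cancelˡ x) (λ i → S-closed x i x∈S)
      S′ = proj₁ removed
      card = proj₁ (proj₂ removed)
      mem = proj₂ (proj₂ removed)
      ∣S′∣≤n : ∣ S′ ∣ ℕ.≤ n
      ∣S′∣≤n = ℕ.≤-trans (ℕ.m≤n+m ∣ S′ ∣ m) (ℕ.s≤s⁻¹ (subst (ℕ._≤ suc n) (trans (sym eq) card) ∣S∣≤n))
      S′-closed : ∀ y i → y ∈ S′ → y + f i ∈ S′
      S′-closed y i y∈S′ = Equivalence.from (mem _) (S-closed y i (proj₁ (Equivalence.to (mem y) y∈S′)) , avoid)
        where
        -- If y + f i lay in the removed coset of x, then y = x + (f j - f i) would lie in it too.
        avoid : ∀ j → x + f j ≢ y + f i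
        avoid j eq = proj₂ (Equivalence.to (mem y) y∈S′) (proj₁ (closed j i)) (begin
          x + f (proj₁ (closed j i))    ≡⟨ cong (x +_) (proj₂ (closed j i)) ⟩
          x + (f j + - f i)             ≡⟨ solve 3 (λ x u v → x :+ (u :+ :- v) := x :+ u :+ :- v) refl x (f j) (f i) ⟩
          x + f j + - f i               ≡⟨ cong (_+ - f i) eq ⟩
          y + f i + - f i               ≡⟨ solve 2 (λ y v → y :+ v :+ :- v := y) refl y (f i) ⟩
          y                             ∎)
          where open ≡-Reasoning

-- Maps that preserve B.

module Stabiliser {q : ℕ} (F : FiniteFieldOn q) (θ : Fin q) (θ-primitive : FiniteFieldOn.IsPrimitive F θ)
                  (k′ r : ℕ) .{{_ : ℕ.NonZero r}} (q≡1+kr : q ≡ suc (suc k′ ℕ.* r)) where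
  open Field F
  open Polynomials F
  open BinomialEquations F
  open AdditiveSubgroup F
  open ProjectiveLine F
  k = suc k′
  open BaseBlock F θ θ-primitive k r q≡1+kr
  open ≡-Reasoning

  Preserves : PGL → Set
  Preserves M = ∀ P → ℬ P → ℬ (M ⟨$⟩ P)

  -- No element of B is ∞, so the image is finite and the denominator can be cleared.
  preserves-coords : ∀ M → Preserves M → ∀ x → ℬ (suc x) →
    ∃ λ y → (PGL.a M * x + PGL.b M ≡ (PGL.c M * x + PGL.d M) * y) × ℬ (suc y)
  preserves-coords M@(pgl a b c d det≢0) pres x x∈ℬ = lemma _ (pres (suc x) x∈ℬ) (⟨$⟩-coords M (coords (suc x)))
    where
    lemma : ∀ P → ℬ P → Coords P (a * x + b * 1#) (c * x + d * 1#) →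
            ∃ λ y → (a * x + b ≡ (c * x + d) * y) × ℬ (suc y)
    lemma (suc y) y∈ℬ xy =
      y , proj₂ (coords-suc (coords-≡ (cong (a * x +_) (*-identityʳ b)) (cong (c * x +_) (*-identityʳ d)) xy)) , y∈ℬ

  ⟨$⟩-suc : ∀ M {x y} → M ⟨$⟩ suc x ≡ suc y →
    PGL.c M * x + PGL.d M ≢ 0# × PGL.a M * x + PGL.b M ≡ (PGL.c M * x + PGL.d M) * y
  ⟨$⟩-suc M@(pgl a b c d _) {x} Mx≡y =
    coords-suc (coords-≡ (cong (a * x +_) (*-identityʳ b)) (cong (c * x +_) (*-identityʳ d))
      (subst (λ P → Coords P _ _) Mx≡y (⟨$⟩-coords M (coords (suc x)))))

  suc-⟨$⟩ : ∀ M {x y} → PGL.c M * x + PGL.d M ≢ 0# → PGL.a M * x + PGL.b M ≡ (PGL.c M * x + PGL.d M) * y →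
            M ⟨$⟩ suc x ≡ suc y
  suc-⟨$⟩ M@(pgl a b c d _) {x} v≢0 u≡vy = coords-unique (⟨$⟩-coords M (coords (suc x)))
    (coords-≡ (trans (sym u≡vy) (cong (a * x +_) (sym (*-identityʳ b)))) (cong (c * x +_) (sym (*-identityʳ d))) (suc-coords v≢0))

  -- If (1 + c x)ᵏ is constant on the k-th roots of unity, then reducing modulo xᵏ − 1 kills the coefficient k c of x.
  constant⇒c≡0 : 1 ℕ.≤ k′ → ∀ c e → (∀ x → x ^ k ≡ 1# → (1# + c * x) ^ k ≡ e) → c ≡ 0#
  constant⇒c≡0 1≤k′ c e const = xy≡0⇒y≡0 ιk≢0 (begin
    ι k * c                 ≡⟨ cong₂ (λ u v → ι u * v) (sym (nC1≡n k)) (sym (*-identityʳ c)) ⟩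
    ι (k C 1) * (c * 1#)    ≡⟨ roots⇒≡0 k E (λ i → ω ^ toℕ i) (λ {i} {j} eq → Fin.toℕ-injective (ω^-injective (Fin.toℕ<n i) (Fin.toℕ<n j) eq)) E-root 1 (ℕ.s≤s 1≤k′) ⟩
    0#                      ∎)
    where
    A E : ℕ → Fin q
    A = binomialCoeff k c
    -- On k-th roots of unity xᵏ = 1, so the top coefficient folds onto the constant term. What
    -- remains has k terms and k roots; 1 ≤ k′ keeps index 1 below k.
    E zero    = A 0 + A k + - e
    E (suc i) = A (suc i)
    E-root : ∀ (i : Fin k) → eval k E (ω ^ toℕ i) ≡ 0#
    E-root i = begin
      A 0 + A k + - e + x * R
        ≡⟨ solve 4 (λ a b e z → a :+ b :+ :- e :+ z := a :+ z :+ b :* 1: :+ :- e) refl (A 0) (A k) e (x * R) ⟩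
      A 0 + x * R + A k * 1# + - e            ≡⟨ cong (λ z → A 0 + x * R + A k * z + - e) (ω^i-root (toℕ i)) ⟨
      eval k A x + A k * x ^ k + - e          ≡⟨ cong (_+ - e) (eval-last k A x) ⟨
      eval (suc k) A x + - e                  ≡⟨ cong (_+ - e) (binomial k c x) ⟩
      (1# + c * x) ^ k + - e                  ≡⟨ x≡y⇒x-y≡0 (const x (ω^i-root (toℕ i))) ⟩
      0#                                      ∎
      where
      x = ω ^ toℕ i
      R = eval k′ (A ∘ suc) x

  fixes-𝟘⇒scaling : 1 ℕ.≤ k′ → ∀ M → Preserves M → M ⟨$⟩ 𝟘 ≡ 𝟘 → ∃ λ u → ∀ x → M ⟨$⟩ suc x ≡ suc (u * x)
  fixes-𝟘⇒scaling 1≤k′ M@(pgl a b c d det≢0) pres M0≡0 = w * a , λ x →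
    suc-⟨$⟩ M (λ eq → d≢0 (trans (sym (v≡d x)) eq)) (begin
      a * x + b                     ≡⟨ cong (a * x +_) b≡0 ⟩
      a * x + 0#                    ≡⟨ solve 2 (λ a x → a :* x :+ 0: := 1: :* (a :* x)) refl a x ⟩
      1# * (a * x)                  ≡⟨ cong (_* (a * x)) (inverse d d≢0) ⟨
      d * w * (a * x)               ≡⟨ solve 4 (λ d w a x → d :* w :* (a :* x) := d :* (w :* a :* x)) refl d w a x ⟩
      d * (w * a * x)               ≡⟨ cong (_* (w * a * x)) (v≡d x) ⟨
      (c * x + d) * (w * a * x)     ∎)
    where
    -- Dividing by d brings c x + d to the shape 1 + (w c) x required by `constant⇒c≡0`.
    w = d ⁻¹
    b≡0 : b ≡ 0#
    b≡0 = trans (solve 2 (λ a b → b := a :* 0: :+ b) refl a b) (trans (proj₂ (⟨$⟩-suc M M0≡0)) (zeroʳ _))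
    d≢0 : d ≢ 0#
    d≢0 d≡0 = proj₁ (⟨$⟩-suc M M0≡0) (trans (solve 2 (λ c d → c :* 0: :+ d := d) refl c d) d≡0)
    a≢0 : a ≢ 0#
    a≢0 a≡0 = det≢0 (trans (cong₂ (λ y z → y * d + - (z * c)) a≡0 b≡0) (solve 2 (λ c d → 0: :* d :+ :- (0: :* c) := 0:) refl c d))
    const : ∀ x → x ^ k ≡ 1# → (1# + w * c * x) ^ k ≡ (w * a) ^ k
    const x x^k≡1 with preserves-coords M pres x (inj₂ x^k≡1)
    ... | y , u≡vy , inj₁ y≡0 = contradiction
      (begin
        a * x              ≡⟨ +-identityʳ _ ⟨
        a * x + 0#         ≡⟨ cong (a * x +_) b≡0 ⟨
        a * x + b          ≡⟨ u≡vy ⟩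
        (c * x + d) * y    ≡⟨ cong ((c * x + d) *_) y≡0 ⟩
        (c * x + d) * 0#   ≡⟨ zeroʳ _ ⟩
        0#                 ∎)
      (xy≢0 a≢0 (x^k≡1⇒x≢0 x^k≡1))
    ... | y , u≡vy , inj₂ y^k≡1 = begin
      (1# + w * c * x) ^ k                ≡⟨ *-identityʳ _ ⟨
      (1# + w * c * x) ^ k * 1#           ≡⟨ cong ((1# + w * c * x) ^ k *_) y^k≡1 ⟨
      (1# + w * c * x) ^ k * y ^ k        ≡⟨ ^-distrib-* _ y k ⟨
      ((1# + w * c * x) * y) ^ k          ≡⟨ cong (_^ k) scaled ⟩
      (w * a * x) ^ k                     ≡⟨ ^-distrib-* (w * a) x k ⟩
      (w * a) ^ k * x ^ k                 ≡⟨ cong ((w * a) ^ k *_) x^k≡1 ⟩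
      (w * a) ^ k * 1#                    ≡⟨ *-identityʳ _ ⟩
      (w * a) ^ k                         ∎
      where
      scaled : (1# + w * c * x) * y ≡ w * a * x
      scaled = begin
        (1# + w * c * x) * y        ≡⟨ cong (λ z → (z + w * c * x) * y) (inverseˡ d d≢0) ⟨
        (w * d + w * c * x) * y     ≡⟨ solve 5 (λ w d c x y → (w :* d :+ w :* c :* x) :* y := w :* ((c :* x :+ d) :* y)) refl w d c x y ⟩
        w * ((c * x + d) * y)       ≡⟨ cong (w *_) u≡vy ⟨
        w * (a * x + b)             ≡⟨ cong (λ z → w * (a * x + z)) b≡0 ⟩
        w * (a * x + 0#)            ≡⟨ solve 3 (λ w a x → w :* (a :* x :+ 0:) := w :* a :* x) refl w a x ⟩
        w * a * x                   ∎
    c≡0 : c ≡ 0#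
    c≡0 = xy≡0⇒y≡0 (x⁻¹≢0 d≢0) (constant⇒c≡0 1≤k′ (w * c) _ const)
    v≡d : ∀ x → c * x + d ≡ d
    v≡d x = trans (cong (λ z → z * x + d) c≡0) (solve 2 (λ x d → 0: :* x :+ d := d) refl x d)

  -- Divided by x, the difference (1 + c x)ᵏ - (1 - x)ᵏ has k terms and vanishes at the k - 1 roots
  -- of unity other than 1. So does 1 + ⋯ + xᵏ⁻¹, and subtracting the right multiple removes the top
  -- term; `roots⇒≡0` then makes the coefficients of x, ..., xᵏ all equal. For c = -1 the assumed
  -- identity would be trivial.
  swap⇒c≡0 : 4 ℕ.≤ k → ∀ c → c + 1# ≢ 0# →
             (∀ x → x ^ k ≡ 1# → x ≢ 1# → (1# + c * x) ^ k ≡ (1# + - 1# * x) ^ k) → c ≡ 0#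
  swap⇒c≡0 4≤k c c+1≢0 swap = swapCoeffs≡⇒c≡0 k c ιk≢0 c+1≢0
    (A≡ 1 (ℕ.≤-trans (ℕ.s≤s (ℕ.s≤s ℕ.z≤n)) 4≤k)) (A≡ 2 (ℕ.≤-trans (ℕ.s≤s (ℕ.s≤s (ℕ.s≤s ℕ.z≤n))) 4≤k)) (A≡ 3 4≤k)
    where
    A E : ℕ → Fin q
    A = swapCoeff k c
    E i = A (suc i) + - A k * 1#

    Ek′≡0 : E k′ ≡ 0#
    Ek′≡0 = solve 1 (λ a → a :+ :- a :* 1: := 0:) refl (A k)

    E-root : ∀ (i : Fin k′) → eval k′ E (ω ^ suc (toℕ i)) ≡ 0#
    E-root i = begin
      eval k′ E x                                        ≡⟨ solve 2 (λ e y → e := e :+ 0: :* y) refl (eval k′ E x) (x ^ k′) ⟩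
      eval k′ E x + 0# * x ^ k′                          ≡⟨ cong (λ z → eval k′ E x + z * x ^ k′) Ek′≡0 ⟨
      eval k′ E x + E k′ * x ^ k′                        ≡⟨ eval-last k′ E x ⟨
      eval k E x                                         ≡⟨ eval-linear k (A ∘ suc) (- A k) (λ _ → 1#) x ⟩
      eval k (A ∘ suc) x + - A k * eval k (λ _ → 1#) x   ≡⟨ cong₂ (λ u v → u + - A k * v) first second ⟩
      0# + - A k * 0#                                    ≡⟨ solve 1 (λ a → 0: :+ :- a :* 0: := 0:) refl (A k) ⟩
      0#                                                 ∎
      where
      x = ω ^ suc (toℕ i)
      x^k≡1 : x ^ k ≡ 1#
      x^k≡1 = ω^i-root (suc (toℕ i))
      x≢1 : x ≢ 1#
      x≢1 eq = ω^i≢ω^j ℕ.z<s (ℕ.s<s (Fin.toℕ<n i)) (sym eq)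
      second : eval k (λ _ → 1#) x ≡ 0#
      second = xy≡0⇒y≡0 (λ eq → x≢1 (sym (x-y≡0⇒x≡y eq))) (trans (geometric k x) (x≡y⇒x-y≡0 (sym x^k≡1)))
      first : eval k (A ∘ suc) x ≡ 0#
      first = xy≡0⇒y≡0 (x^k≡1⇒x≢0 x^k≡1) (begin
        x * eval k (A ∘ suc) x        ≡⟨ solve 1 (λ z → z := 1: :* 1: :+ :- 1: :* (1: :* 1:) :+ z) refl (x * eval k (A ∘ suc) x) ⟩
        eval (suc k) A x
          ≡⟨ eval-linear (suc k) (binomialCoeff k c) (- 1#) (binomialCoeff k (- 1#)) x ⟩
        eval (suc k) (binomialCoeff k c) x + - 1# * eval (suc k) (binomialCoeff k (- 1#)) x
          ≡⟨ cong₂ (λ u v → u + - 1# * v) (binomial k c x) (binomial k (- 1#) x) ⟩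
        (1# + c * x) ^ k + - 1# * (1# + - 1# * x) ^ k
          ≡⟨ cong (_+ - 1# * (1# + - 1# * x) ^ k) (swap x x^k≡1 x≢1) ⟩
        (1# + - 1# * x) ^ k + - 1# * (1# + - 1# * x) ^ k
          ≡⟨ solve 1 (λ z → z :+ :- 1: :* z := 0:) refl ((1# + - 1# * x) ^ k) ⟩
        0# ∎)

    E≡0 : ∀ i → i ℕ.< k → E i ≡ 0#
    E≡0 i i<k with i ℕ.≟ k′
    ... | yes refl = Ek′≡0
    ... | no  i≢k′ = roots⇒≡0 k′ E (λ i → ω ^ suc (toℕ i))
      (λ {i} {j} eq → Fin.toℕ-injective (ℕ.suc-injective (ω^-injective (ℕ.s<s (Fin.toℕ<n i)) (ℕ.s<s (Fin.toℕ<n j)) eq)))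
      E-root i (ℕ.≤∧≢⇒< (ℕ.s≤s⁻¹ i<k) i≢k′)

    A≡ : ∀ i → i ℕ.< k → A (suc i) ≡ A 1
    A≡ i i<k = both≡z (E≡0 i i<k) (E≡0 0 ℕ.z<s)
      where
      both≡z : ∀ {x y z} → x + - z * 1# ≡ 0# → y + - z * 1# ≡ 0# → x ≡ y
      both≡z {x} {y} {z} p p′ = x-y≡0⇒x≡y (combine₂ 1# (- 1#) p p′
        (solve 3 (λ x y z → x :+ :- y := 1: :* (x :+ :- z :* 1: :+ :- 0:) :+ :- 1: :* (y :+ :- z :* 1: :+ :- 0:)) refl x y z))

  -- The values at 0 and 1 give b = d and a = -b, so the map is (1 - x)/(1 + w c x), and w c ≠ -1
  -- because 1 is not a pole. Once w c = 0, only 1 - x is left.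
  swap⇒1-x : 4 ℕ.≤ k → ∀ M → Preserves M → M ⟨$⟩ 𝟘 ≡ 𝟙 → M ⟨$⟩ 𝟙 ≡ 𝟘 → ∀ x → ℬ (suc x) → ℬ (suc (1# + - x))
  swap⇒1-x 4≤k M@(pgl a b c d det≢0) pres M0≡1 M1≡0 x x∈ℬ = finish (quotient-coords x x∈ℬ)
    where
    w = d ⁻¹
    b≡d : b ≡ d
    b≡d = begin
      b                    ≡⟨ solve 2 (λ a b → b := a :* 0: :+ b) refl a b ⟩
      a * 0# + b           ≡⟨ proj₂ (⟨$⟩-suc M M0≡1) ⟩
      (c * 0# + d) * 1#    ≡⟨ solve 2 (λ c d → (c :* 0: :+ d) :* 1: := d) refl c d ⟩
      d                    ∎
    a+b≡0 : a * 1# + b ≡ 0#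
    a+b≡0 = trans (proj₂ (⟨$⟩-suc M M1≡0)) (zeroʳ _)
    d≢0 : d ≢ 0#
    d≢0 d≡0 = proj₁ (⟨$⟩-suc M M0≡1) (trans (solve 2 (λ c d → c :* 0: :+ d := d) refl c d) d≡0)
    quotient-coords : ∀ x → ℬ (suc x) → ∃ λ y → (1# + - 1# * x ≡ (1# + w * c * x) * y) × ℬ (suc y)
    quotient-coords x x∈ℬ with preserves-coords M pres x x∈ℬ
    ... | y , u≡vy , y∈ℬ = y , eq , y∈ℬ
      where
      eq : 1# + - 1# * x ≡ (1# + w * c * x) * y
      eq = begin
        1# + - 1# * x                               ≡⟨ solve 1 (λ x → 1: :+ :- 1: :* x := 1: :* (1: :+ :- x)) refl x ⟩
        1# * (1# + - x)                             ≡⟨ cong (_* (1# + - x)) (inverseˡ d d≢0) ⟨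
        w * d * (1# + - x)                          ≡⟨ cong (λ z → w * z * (1# + - x)) b≡d ⟨
        w * b * (1# + - x)                          ≡⟨ solve 3 (λ w b x → w :* b :* (1: :+ :- x) := w :* (0: :* x :+ b :* (1: :+ :- x))) refl w b x ⟩
        w * (0# * x + b * (1# + - x))               ≡⟨ cong (λ z → w * (z * x + b * (1# + - x))) a+b≡0 ⟨
        w * ((a * 1# + b) * x + b * (1# + - x))     ≡⟨ solve 4 (λ w a b x → w :* ((a :* 1: :+ b) :* x :+ b :* (1: :+ :- x)) := w :* (a :* x :+ b)) refl w a b x ⟩
        w * (a * x + b)                             ≡⟨ cong (w *_) u≡vy ⟩
        w * ((c * x + d) * y)                       ≡⟨ solve 5 (λ w d c x y → w :* ((c :* x :+ d) :* y) := (w :* d :+ w :* c :* x) :* y) refl w d c x y ⟩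
        (w * d + w * c * x) * y                     ≡⟨ cong (λ z → (z + w * c * x) * y) (inverseˡ d d≢0) ⟩
        (1# + w * c * x) * y                        ∎
    swap : ∀ x → x ^ k ≡ 1# → x ≢ 1# → (1# + w * c * x) ^ k ≡ (1# + - 1# * x) ^ k
    swap x x^k≡1 x≢1 with quotient-coords x (inj₂ x^k≡1)
    ... | y , eq , inj₁ y≡0 = contradiction (sym (x-y≡0⇒x≡y (begin
            1# + - x                   ≡⟨ solve 1 (λ x → 1: :+ :- x := 1: :+ :- 1: :* x) refl x ⟩
            1# + - 1# * x              ≡⟨ eq ⟩
            (1# + w * c * x) * y       ≡⟨ cong ((1# + w * c * x) *_) y≡0 ⟩
            (1# + w * c * x) * 0#      ≡⟨ zeroʳ _ ⟩
            0#                         ∎))) x≢1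
    ... | y , eq , inj₂ y^k≡1 = begin
            (1# + w * c * x) ^ k            ≡⟨ *-identityʳ _ ⟨
            (1# + w * c * x) ^ k * 1#       ≡⟨ cong ((1# + w * c * x) ^ k *_) y^k≡1 ⟨
            (1# + w * c * x) ^ k * y ^ k    ≡⟨ ^-distrib-* _ y k ⟨
            ((1# + w * c * x) * y) ^ k      ≡⟨ cong (_^ k) eq ⟨
            (1# + - 1# * x) ^ k             ∎
    wc≡0 : w * c ≡ 0#
    wc≡0 = swap⇒c≡0 4≤k (w * c) (λ wc+1≡0 → proj₁ (⟨$⟩-suc M M1≡0) (begin
      c * 1# + d                  ≡⟨ solve 2 (λ c d → c :* 1: :+ d := 1: :* c :+ d) refl c d ⟩
      1# * c + d                  ≡⟨ cong (λ z → z * c + d) (inverse d d≢0) ⟨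
      d * w * c + d               ≡⟨ solve 3 (λ d w c → d :* w :* c :+ d := d :* (w :* c :+ 1:)) refl d w c ⟩
      d * (w * c + 1#)            ≡⟨ cong (d *_) wc+1≡0 ⟩
      d * 0#                      ≡⟨ zeroʳ d ⟩
      0#                          ∎)) swap
    finish : (∃ λ y → (1# + - 1# * x ≡ (1# + w * c * x) * y) × ℬ (suc y)) → ℬ (suc (1# + - x))
    finish (y , eq , y∈ℬ) = subst (ℬ ∘ suc) (begin
      y                           ≡⟨ solve 2 (λ x y → y := (1: :+ 0: :* x) :* y) refl x y ⟩
      (1# + 0# * x) * y           ≡⟨ cong (λ z → (1# + z * x) * y) wc≡0 ⟨
      (1# + w * c * x) * y        ≡⟨ eq ⟨
      1# + - 1# * x               ≡⟨ solve 1 (λ x → 1: :+ :- 1: :* x := 1: :+ :- x) refl x ⟩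
      1# + - x                    ∎) y∈ℬ

  root-* : ∀ {x y} → x ^ k ≡ 1# → y ^ k ≡ 1# → (x * y) ^ k ≡ 1#
  root-* {x} {y} p p′ = trans (^-distrib-* x y k) (trans (cong₂ _*_ p p′) (*-identityˡ 1#))

  root-⁻¹ : ∀ {x} → x ^ k ≡ 1# → (x ⁻¹) ^ k ≡ 1#
  root-⁻¹ {x} p = begin
    (x ⁻¹) ^ k           ≡⟨ *-identityˡ _ ⟨
    1# * (x ⁻¹) ^ k      ≡⟨ cong (_* (x ⁻¹) ^ k) p ⟨
    x ^ k * (x ⁻¹) ^ k   ≡⟨ ^-distrib-* x (x ⁻¹) k ⟨
    (x * x ⁻¹) ^ k       ≡⟨ cong (_^ k) (inverse x (x^k≡1⇒x≢0 p)) ⟩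
    1# ^ k               ≡⟨ 1^n≡1 k ⟩
    1#                   ∎

  ℬ-scale : ∀ {x y} → x ^ k ≡ 1# → ℬ (suc y) → ℬ (suc (x * y))
  ℬ-scale {x} p (inj₁ refl) = inj₁ (zeroʳ x)
  ℬ-scale p (inj₂ p′)       = inj₂ (root-* p p′)

  -- For a root of unity x, the difference x - y = x (1 - x⁻¹ y) stays in B because B is closed
  -- under multiplication by roots of unity. For x = 0, -y = (1 - y) - 1 reduces to this if y ≠ 1.
  1-x-closed⇒1+k∣q : 1 ℕ.≤ k′ → (∀ x → ℬ (suc x) → ℬ (suc (1# + - x))) → suc k ∣ q
  1-x-closed⇒1+k∣q 1≤k′ 1-x = lagrange element (λ eq → β-injective (cong suc eq)) λ i j →
    let l , eq = β-surjective _ (ℬ-sub (β∈ℬ i) (β∈ℬ j)) in l , Fin.suc-injective eq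
    where
    root-sub : ∀ {x y} → x ^ k ≡ 1# → ℬ (suc y) → ℬ (suc (x + - y))
    root-sub {x} {y} p y∈ℬ = subst (ℬ ∘ suc) (begin
      x * (1# + - (x ⁻¹ * y))     ≡⟨ solve 3 (λ x w y → x :* (1: :+ :- (w :* y)) := x :+ :- (x :* w :* y)) refl x (x ⁻¹) y ⟩
      x + - (x * x ⁻¹ * y)        ≡⟨ cong (λ z → x + - (z * y)) (inverse x (x^k≡1⇒x≢0 p)) ⟩
      x + - (1# * y)              ≡⟨ cong (λ z → x + - z) (*-identityˡ y) ⟩
      x + - y                     ∎) (ℬ-scale p (1-x _ (ℬ-scale (root-⁻¹ p) y∈ℬ)))

    neg : ∀ {y} → ℬ (suc y) → y ≢ 1# → ℬ (suc (- y))
    neg {y} y∈ℬ y≢1 with 1-x y y∈ℬ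
    ... | inj₁ 1-y≡0 = contradiction (sym (x-y≡0⇒x≡y 1-y≡0)) y≢1
    ... | inj₂ p = subst (ℬ ∘ suc) (solve 1 (λ y → 1: :+ :- y :+ :- 1: := :- y) refl y) (root-sub p (inj₂ (1^n≡1 k)))

    -- neg does not cover y = 1, since 1 − y is not a root of unity there; −1 is reached through −ω.
    neg-one : ℬ (suc (- 1#))
    neg-one = subst (ℬ ∘ suc) (begin
      ω ^ k′ * - (ω ^ 1)       ≡⟨ solve 2 (λ w z → z :* :- (w :* 1:) := :- (w :* z)) refl ω (ω ^ k′) ⟩
      - (ω ^ k)                ≡⟨ cong -_ ω^k≡1 ⟩
      - 1#                     ∎)
      (ℬ-scale (ω^i-root k′) (neg (inj₂ (ω^i-root 1)) (λ eq → ω^i≢ω^j ℕ.z<s (ℕ.s≤s 1≤k′) (sym eq))))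

    ℬ-sub : ∀ {x y} → ℬ (suc x) → ℬ (suc y) → ℬ (suc (x + - y))
    ℬ-sub (inj₂ p) y∈ℬ = root-sub p y∈ℬ
    ℬ-sub {y = y} (inj₁ refl) y∈ℬ = subst (ℬ ∘ suc) (sym (+-identityˡ (- y))) neg-y
      where
      neg-y : ℬ (suc (- y))
      neg-y with y ≟ 1#
      ... | yes refl = neg-one
      ... | no  y≢1  = neg y∈ℬ y≢1

-- Decidable subsets, three-element subsets, and indices avoiding two given ones.

⟪_⟫ : ∀ {n} {P : Fin n → Set} → Decidable P → Subset n
⟪ P? ⟫ = Vec.tabulate (does ∘ P?)

∈⟪⟫⇔ : ∀ {n} {P : Fin n → Set} (P? : Decidable P) x → (x ∈ ⟪ P? ⟫) ⇔ P x
∈⟪⟫⇔ {P = P} P? x = mk⇔ to from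
  where
  to : x ∈ ⟪ P? ⟫ → P x
  to x∈ with P? x | trans (sym (lookup∘tabulate (does ∘ P?) x)) ([]=⇒lookup x∈)
  ... | yes px | _ = px
  from : P x → x ∈ ⟪ P? ⟫
  from px = lookup⇒[]= x _ (trans (lookup∘tabulate (does ∘ P?) x) (dec-true (P? x) px))

-- `⊆-three` states that T has no further element, in the form in which blocks are tested for
-- containing T.
record ThreeElements {n} (T : Subset n) : Set where
  field
    t₁ t₂ t₃ : Fin n
    t₁≢t₂    : t₁ ≢ t₂
    t₁≢t₃    : t₁ ≢ t₃
    t₂≢t₃    : t₂ ≢ t₃
    t₁∈T     : t₁ ∈ T
    t₂∈T     : t₂ ∈ T
    t₃∈T     : t₃ ∈ T
    ⊆-three  : ∀ {S} → t₁ ∈ S → t₂ ∈ S → t₃ ∈ S → T ⊆ S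

∣T∣≡3⇒three : ∀ {n} (T : Subset n) → ∣ T ∣ ≡ 3 → ThreeElements T
∣T∣≡3⇒three T ∣T∣≡3
  with t₁ , t₁∈ , c₂ ← ∣p∣≡1+m⇒nonempty T ∣T∣≡3
  with t₂ , t₂∈ , c₁ ← ∣p∣≡1+m⇒nonempty (T ∖ t₁) c₂
  with t₃ , t₃∈ , c₀ ← ∣p∣≡1+m⇒nonempty (T ∖ t₁ ∖ t₂) c₁
  = record
  { t₁ = t₁ ; t₂ = t₂ ; t₃ = t₃
  ; t₁≢t₂ = λ { refl → x∉p-x T t₁ t₂∈ }
  ; t₁≢t₃ = λ { refl → x∉p-x T t₁ (p─q⊆p (T ∖ t₁) _ t₃∈) }
  ; t₂≢t₃ = λ { refl → x∉p-x (T ∖ t₁) t₂ t₃∈ }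
  ; t₁∈T = t₁∈
  ; t₂∈T = p─q⊆p T _ t₂∈
  ; t₃∈T = p─q⊆p T _ (p─q⊆p (T ∖ t₁) _ t₃∈)
  ; ⊆-three = λ {S} t₁∈S t₂∈S t₃∈S {x} x∈T → cover S t₁∈S t₂∈S t₃∈S x x∈T
  }
  where
  cover : ∀ S → t₁ ∈ S → t₂ ∈ S → t₃ ∈ S → ∀ x → x ∈ T → x ∈ S
  cover S t₁∈S t₂∈S t₃∈S x x∈T with x ≟ t₁ | x ≟ t₂ | x ≟ t₃
  ... | yes refl | _        | _        = t₁∈S
  ... | no _     | yes refl | _        = t₂∈S
  ... | no _     | no _     | yes refl = t₃∈S
  ... | no x≢t₁  | no x≢t₂  | no x≢t₃  = contradiction
    (trans (sym c₀) (x∈p⇒∣p∣≡1+∣p-x∣ (x∈p∧x≢y⇒x∈p-y (x∈p∧x≢y⇒x∈p-y (x∈p∧x≢y⇒x∈p-y x∈T x≢t₁) x≢t₂) x≢t₃))) λ ()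

module _ {n} {i₁ i₂ : Fin (suc (suc n))} (i₁≢i₂ : i₁ ≢ i₂) where

  -- Enumerates the indices other than i₁ and i₂; `punchOut i₁≢i₂` is the position of i₂ once i₁ is
  -- removed.
  third : Fin n → Fin (suc (suc n))
  third z = punchIn i₁ (punchIn (punchOut i₁≢i₂) z)

  third≢i₁ : ∀ z → i₁ ≢ third z
  third≢i₁ z eq = Fin.punchInᵢ≢i i₁ _ (sym eq)

  third≢i₂ : ∀ z → i₂ ≢ third z
  third≢i₂ z eq = Fin.punchInᵢ≢i (punchOut i₁≢i₂) z
    (Fin.punchIn-injective i₁ _ _ (trans (sym eq) (sym (Fin.punchIn-punchOut i₁≢i₂))))

  third-injective : ∀ {z z′} → third z ≡ third z′ → z ≡ z′
  third-injective eq = Fin.punchIn-injective (punchOut i₁≢i₂) _ _ (Fin.punchIn-injective i₁ _ _ eq)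

  third-surjective : ∀ i → i₁ ≢ i → i₂ ≢ i → ∃ λ z → third z ≡ i
  third-surjective i i₁≢i i₂≢i = punchOut ne ,
    trans (cong (punchIn i₁) (Fin.punchIn-punchOut ne)) (Fin.punchIn-punchOut i₁≢i)
    where
    ne : punchOut i₁≢i₂ ≢ punchOut i₁≢i
    ne eq = i₂≢i (Fin.punchOut-injective i₁≢i₂ i₁≢i eq)

-- Blocks through a three-element set.

module Counting {q : ℕ} (F : FiniteFieldOn q) (θ : Fin q) (θ-primitive : FiniteFieldOn.IsPrimitive F θ)
                (k′ r : ℕ) .{{_ : ℕ.NonZero r}} (q≡1+kr : q ≡ suc (suc k′ ℕ.* r)) where
  open FiniteFieldOn F using (IsBlock)
  open ProjectiveLine F
  open Stabiliser F θ θ-primitive k′ r q≡1+kr using (k)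
  open BaseBlock F θ θ-primitive k r q≡1+kr

  Stab : PGL → Set
  Stab M = ∀ P → ℬ P ⇔ ℬ (M ⟨$⟩ P)

  -- S = M(B), tested by pulling back along M so that membership is decidable.
  IsImage : PGL → Subset (suc q) → Set
  IsImage M S = ∀ y → (y ∈ S) ⇔ ℬ (M ⁻ ⟨$⟩ y)

  isBlock⇒isImage : ∀ {S} → IsBlock θ r S → ∃ λ M → IsImage M S
  isBlock⇒isImage {S} (a , b , c , d , det≢0 , image) = M , λ y → mk⇔ (to y) (from y)
    where
    M = pgl a b c d det≢0
    to : ∀ y → y ∈ S → ℬ (M ⁻ ⟨$⟩ y)
    to y y∈S with x , x∈B , Mx≡y ← Equivalence.to (image y) y∈S =
      subst ℬ (sym (⁻-⟨$⟩ M {x} Mx≡y)) (Equivalence.to (InB⇔ℬ x) x∈B)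
    from : ∀ y → ℬ (M ⁻ ⟨$⟩ y) → y ∈ S
    from y y∈ = Equivalence.from (image y) (M ⁻ ⟨$⟩ y , Equivalence.from (InB⇔ℬ _) y∈ , ⁻-inverseʳ M y)

  isImage⇒isBlock : ∀ {S} M → IsImage M S → IsBlock θ r S
  isImage⇒isBlock {S} M@(pgl a b c d det≢0) image = a , b , c , d , det≢0 , λ y → mk⇔ (to y) (from y)
    where
    to : ∀ y → y ∈ S → ∃ λ x → FiniteFieldOn.InB F θ r x × M ⟨$⟩ x ≡ y
    to y y∈S = M ⁻ ⟨$⟩ y , Equivalence.from (InB⇔ℬ _) (Equivalence.to (image y) y∈S) , ⁻-inverseʳ M y
    from : ∀ y → (∃ λ x → FiniteFieldOn.InB F θ r x × M ⟨$⟩ x ≡ y) → y ∈ S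
    from y (x , x∈B , Mx≡y) = Equivalence.from (image y) (subst ℬ (sym (⁻-⟨$⟩ M {x} Mx≡y)) (Equivalence.to (InB⇔ℬ x) x∈B))

  abstract
    block : PGL → Subset (suc q)
    block M = ⟪ (λ y → ℬ? (M ⁻ ⟨$⟩ y)) ⟫

    block-isImage : ∀ M → IsImage M (block M)
    block-isImage M = ∈⟪⟫⇔ (λ y → ℬ? (M ⁻ ⟨$⟩ y))

  block-card : ∀ S → IsBlock θ r S → ∣ S ∣ ≡ suc k
  block-card S S-block = lemma (isBlock⇒isImage S-block)
    where
    lemma : (∃ λ M → IsImage M S) → ∣ S ∣ ≡ suc k
    lemma (M , image) = card-image S (λ i → M ⟨$⟩ β i) (β-injective ∘ ⟨$⟩-injective M) λ y → mk⇔
      (λ y∈S → let i , βi≡ = β-surjective _ (Equivalence.to (image y) y∈S)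
               in i , trans (cong (M ⟨$⟩_) βi≡) (⁻-inverseʳ M y))
      (λ { (i , refl) → Equivalence.from (image y) (subst ℬ (sym (⁻-inverseˡ M (β i))) (β∈ℬ i)) })

  -- Representatives of the orbits of the stabiliser of B on ordered pairs of distinct elements of B,
  -- on which it acts freely.
  record PairTransversal (m : ℕ) : Set where
    field
      fst snd : Fin m → Fin (suc k)
      fst≢snd : ∀ j → fst j ≢ snd j
      reach   : ∀ i₁ i₂ → i₁ ≢ i₂ → ∃ λ j → ∃ λ h → Stab h × (h ⟨$⟩ β i₁ ≡ β (fst j)) × (h ⟨$⟩ β i₂ ≡ β (snd j))
      rigid   : ∀ h → Stab h → ∀ j j′ → h ⟨$⟩ β (fst j) ≡ β (fst j′) → h ⟨$⟩ β (snd j) ≡ β (snd j′) →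
                j ≡ j′ × (∀ i → h ⟨$⟩ β i ≡ β i)

  module _ {m} (transversal : PairTransversal m) {T : Subset (suc q)} (T-three : ThreeElements T) where
    open PairTransversal transversal
    open ThreeElements T-three

    -- A representative pair and one of the k′ = k - 1 other elements of B. By freeness on pairs,
    -- different third elements lie in different orbits.
    Triple : Set
    Triple = Fin m × Fin k′

    b₁ b₂ b₃ : Triple → X
    b₁ (j , z) = β (fst j)
    b₂ (j , z) = β (snd j)
    b₃ (j , z) = β (third (fst≢snd j) z)

    b₁≢b₂ : ∀ τ → b₁ τ ≢ b₂ τ
    b₁≢b₂ (j , z) eq = fst≢snd j (β-injective eq)

    b₁≢b₃ : ∀ τ → b₁ τ ≢ b₃ τ
    b₁≢b₃ (j , z) eq = third≢i₁ (fst≢snd j) z (β-injective eq)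

    b₂≢b₃ : ∀ τ → b₂ τ ≢ b₃ τ
    b₂≢b₃ (j , z) eq = third≢i₂ (fst≢snd j) z (β-injective eq)

    abstract
      carrier : ∀ τ → ∃ λ M → Sends M (b₁ τ) (b₂ τ) (b₃ τ) t₁ t₂ t₃
      carrier τ = transitive (b₁≢b₂ τ) (b₁≢b₃ τ) (b₂≢b₃ τ) t₁≢t₂ t₁≢t₃ t₂≢t₃

    g : Triple → PGL
    g τ = proj₁ (carrier τ)

    g-sends : ∀ τ → Sends (g τ) (b₁ τ) (b₂ τ) (b₃ τ) t₁ t₂ t₃
    g-sends τ = proj₂ (carrier τ)

    T⊆block : ∀ τ → T ⊆ block (g τ)
    T⊆block τ@(j , z) = contained (g τ) (g-sends τ)
      where
      contained : ∀ M → Sends M (b₁ τ) (b₂ τ) (b₃ τ) t₁ t₂ t₃ → T ⊆ block M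
      contained M (e₁ , e₂ , e₃) = ⊆-three (covered (fst j) e₁) (covered (snd j) e₂) (covered (third (fst≢snd j) z) e₃)
        where
        covered : ∀ i {t} → M ⟨$⟩ β i ≡ t → t ∈ block M
        covered i e = Equivalence.from (block-isImage M _) (subst ℬ (sym (⁻-⟨$⟩ M e)) (β∈ℬ i))

    -- If M(B) = N(B), then N⁻¹M stabilises B and carries one representative pair to the other. By
    -- `rigid` the pairs agree and N⁻¹M is the identity on B, so the third elements agree too.
    block∘g-injective : ∀ τ τ′ → block (g τ) ≡ block (g τ′) → τ ≡ τ′
    block∘g-injective τ@(j , z) τ′@(j′ , z′) = lemma (g τ) (g τ′) (g-sends τ) (g-sends τ′)
      where
      lemma : ∀ M N → Sends M (b₁ τ) (b₂ τ) (b₃ τ) t₁ t₂ t₃ → Sends N (b₁ τ′) (b₂ τ′) (b₃ τ′) t₁ t₂ t₃ →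
              block M ≡ block N → τ ≡ τ′
      lemma M N (M₁ , M₂ , M₃) (N₁ , N₂ , N₃) eq = conclude (rigid h h-stab j j′ (sends M₁ N₁) (sends M₂ N₂))
        where
        h = N ⁻ ⊙ M
        h-⟨$⟩ : ∀ P → h ⟨$⟩ P ≡ N ⁻ ⟨$⟩ M ⟨$⟩ P
        h-⟨$⟩ = ⊙-⟨$⟩ (N ⁻) M
        h-stab : Stab h
        h-stab P = mk⇔
          (λ P∈ℬ → subst ℬ (sym (h-⟨$⟩ P)) (Equivalence.to (block-isImage N _) (subst (M ⟨$⟩ P ∈_) eq
            (Equivalence.from (block-isImage M _) (subst ℬ (sym (⁻-inverseˡ M P)) P∈ℬ)))))
          (λ hP∈ℬ → subst ℬ (⁻-inverseˡ M P) (Equivalence.to (block-isImage M _) (subst (M ⟨$⟩ P ∈_) (sym eq)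
            (Equivalence.from (block-isImage N _) (subst ℬ (h-⟨$⟩ P) hP∈ℬ)))))
        sends : ∀ {P Q t} → M ⟨$⟩ P ≡ t → N ⟨$⟩ Q ≡ t → h ⟨$⟩ P ≡ Q
        sends {P} e e′ = trans (h-⟨$⟩ P) (trans (cong (N ⁻ ⟨$⟩_) e) (⁻-⟨$⟩ N e′))
        conclude : j ≡ j′ × (∀ i → h ⟨$⟩ β i ≡ β i) → τ ≡ τ′
        conclude (refl , h-id) = cong (j ,_)
          (third-injective (fst≢snd j) (β-injective (trans (sym (h-id (third (fst≢snd j) z))) (sends M₃ N₃))))

    -- For S = M(B), the points of T pull back into B, and some h in the stabiliser moves the first
    -- two to a representative pair. With N the map chosen for the resulting triple, h M⁻¹ N fixes
    -- three points, hence N⁻¹ = h M⁻¹ and N(B) = M(B).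
    block∘g-surjective : ∀ {S} → IsBlock θ r S → T ⊆ S → ∃ λ τ → S ≡ block (g τ)
    block∘g-surjective {S} S-block T⊆S = lemma₁ (isBlock⇒isImage S-block)
      where
      module _ (M : PGL) (image : IsImage M S) where
        preimage : ∀ {t} → t ∈ T → ∃ λ i → β i ≡ M ⁻ ⟨$⟩ t
        preimage t∈T = β-surjective _ (Equivalence.to (image _) (T⊆S t∈T))

        distinct : ∀ {t t′} i i′ → t ≢ t′ → β i ≡ M ⁻ ⟨$⟩ t → β i′ ≡ M ⁻ ⟨$⟩ t′ → i ≢ i′
        distinct i i′ t≢t′ e e′ refl = t≢t′ (⟨$⟩-injective (M ⁻) (trans (sym e) e′))

        module _ i₁ i₂ i₃ (e₁ : β i₁ ≡ M ⁻ ⟨$⟩ t₁) (e₂ : β i₂ ≡ M ⁻ ⟨$⟩ t₂) (e₃ : β i₃ ≡ M ⁻ ⟨$⟩ t₃)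
                 j h (h-stab : Stab h) (h₁ : h ⟨$⟩ β i₁ ≡ β (fst j)) (h₂ : h ⟨$⟩ β i₂ ≡ β (snd j)) where

          identify : ∀ z → h ⟨$⟩ β i₃ ≡ b₃ (j , z) → ∀ N → Sends N (b₁ (j , z)) (b₂ (j , z)) (b₃ (j , z)) t₁ t₂ t₃ → S ≡ block N
          identify z h₃ N (N₁ , N₂ , N₃) = ⊆-antisym
            (λ {y} y∈S → Equivalence.from (block-isImage N y)
               (subst ℬ (sym (N⁻≡hM⁻ y)) (Equivalence.to (h-stab _) (Equivalence.to (image y) y∈S))))
            (λ {y} y∈ → Equivalence.from (image y)
               (Equivalence.from (h-stab _) (subst ℬ (N⁻≡hM⁻ y) (Equivalence.to (block-isImage N y) y∈))))
            where
            K = h ⊙ M ⁻ ⊙ N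
            K-⟨$⟩ : ∀ P → K ⟨$⟩ P ≡ h ⟨$⟩ M ⁻ ⟨$⟩ N ⟨$⟩ P
            K-⟨$⟩ P = trans (⊙-⟨$⟩ h (M ⁻ ⊙ N) P) (cong (h ⟨$⟩_) (⊙-⟨$⟩ (M ⁻) N P))
            fixes : ∀ P i {t} → N ⟨$⟩ P ≡ t → β i ≡ M ⁻ ⟨$⟩ t → h ⟨$⟩ β i ≡ P → K ⟨$⟩ P ≡ P
            fixes P i NP e hi = trans (K-⟨$⟩ P) (trans (cong (λ Q → h ⟨$⟩ M ⁻ ⟨$⟩ Q) NP) (trans (cong (h ⟨$⟩_) (sym e)) hi))
            N⁻≡hM⁻ : ∀ y → N ⁻ ⟨$⟩ y ≡ h ⟨$⟩ M ⁻ ⟨$⟩ y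
            N⁻≡hM⁻ y = trans
              (sym (fixes-three⇒id (b₁≢b₂ (j , z)) (b₁≢b₃ (j , z)) (b₂≢b₃ (j , z)) K (fixes (b₁ (j , z)) i₁ N₁ e₁ h₁ , fixes (b₂ (j , z)) i₂ N₂ e₂ h₂ , fixes (b₃ (j , z)) i₃ N₃ e₃ h₃) (N ⁻ ⟨$⟩ y)))
              (trans (K-⟨$⟩ (N ⁻ ⟨$⟩ y)) (cong (λ Q → h ⟨$⟩ M ⁻ ⟨$⟩ Q) (⁻-inverseʳ N y)))

          lemma₃ : ∃ λ τ → S ≡ block (g τ)
          lemma₃ with l , βl≡ ← β-surjective _ (Equivalence.to (h-stab _) (β∈ℬ i₃))
                 with z , third≡ ← third-surjective (fst≢snd j) l
                   (λ { refl → distinct i₁ i₃ t₁≢t₃ e₁ e₃ (β-injective (⟨$⟩-injective h (trans h₁ βl≡))) })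
                   (λ { refl → distinct i₂ i₃ t₂≢t₃ e₂ e₃ (β-injective (⟨$⟩-injective h (trans h₂ βl≡))) })
                 = (j , z) , identify z (trans (sym βl≡) (cong β (sym third≡))) (g (j , z)) (g-sends (j , z))

        lemma₂ : (∃ λ i → β i ≡ M ⁻ ⟨$⟩ t₁) → (∃ λ i → β i ≡ M ⁻ ⟨$⟩ t₂) → (∃ λ i → β i ≡ M ⁻ ⟨$⟩ t₃) → ∃ λ τ → S ≡ block (g τ)
        lemma₂ (i₁ , e₁) (i₂ , e₂) (i₃ , e₃) with j , h , h-stab , h₁ , h₂ ← reach i₁ i₂ (distinct i₁ i₂ t₁≢t₂ e₁ e₂) =
          lemma₃ i₁ i₂ i₃ e₁ e₂ e₃ j h h-stab h₁ h₂

      lemma₁ : (∃ λ M → IsImage M S) → ∃ λ τ → S ≡ block (g τ)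
      lemma₁ (M , image) = lemma₂ M image (preimage M image t₁∈T) (preimage M image t₂∈T) (preimage M image t₃∈T)

    blocks-through : ∃ λ (L : List (Subset (suc q))) →
      (length L ≡ m ℕ.* k′) × Unique L × (∀ S → (S ∈L L) ⇔ (IsBlock θ r S × T ⊆ S))
    blocks-through = List.tabulate f , length-tabulate f , tabulate⁺ f-injective , λ S → mk⇔ (to S) (from S)
      where
      triple : Fin (m ℕ.* k′) → Triple
      triple = remQuot {m} k′
      f : Fin (m ℕ.* k′) → Subset (suc q)
      f n = block (g (triple n))
      f-injective : ∀ {n n′} → f n ≡ f n′ → n ≡ n′
      f-injective {n} {n′} eq = begin
        n                            ≡⟨ Fin.combine-remQuot {m} k′ n ⟨
        uncurry combine (triple n)   ≡⟨ cong (uncurry combine) (block∘g-injective (triple n) (triple n′) eq) ⟩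
        uncurry combine (triple n′)  ≡⟨ Fin.combine-remQuot {m} k′ n′ ⟩
        n′                           ∎
        where open ≡-Reasoning
      member : ∀ τ {S} → S ≡ block (g τ) → IsBlock θ r S × T ⊆ S
      member τ refl = isImage⇒isBlock (g τ) (block-isImage (g τ)) , T⊆block τ
      to : ∀ S → S ∈L List.tabulate f → IsBlock θ r S × T ⊆ S
      to S S∈L = let n , S≡fn = ∈-tabulate⁻ S∈L in member (triple n) S≡fn
      listed : ∀ {S} → (∃ λ τ → S ≡ block (g τ)) → S ∈L List.tabulate f
      listed ((j , z) , S≡) = subst (_∈L List.tabulate f)
        (trans (cong (λ τ → block (g τ)) (Fin.remQuot-combine {m} {k′} j z)) (sym S≡)) (∈-tabulate⁺ (combine {m} {k′} j z))
      from : ∀ S → IsBlock θ r S × T ⊆ S → S ∈L List.tabulate f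
      from S (S-block , T⊆S) = listed (block∘g-surjective S-block T⊆S)

-- The values of λ for k ≠ 3.

lam-∣ : ∀ q k → k ≢ 3 → suc k ∣ q → lam q k ≡ k ℕ.∸ 1
lam-∣ q k k≢3 1+k∣q with k ℕ.≟ 3
... | yes k≡3 = contradiction k≡3 k≢3
... | no _ with suc k ∣? q
...   | yes _     = refl
...   | no 1+k∤q = contradiction 1+k∣q 1+k∤q

lam-∤ : ∀ q k → k ≢ 3 → ¬ (suc k ∣ q) → lam q k ≡ suc k ℕ.* (k ℕ.∸ 1)
lam-∤ q k k≢3 1+k∤q with k ℕ.≟ 3
... | yes k≡3 = contradiction k≡3 k≢3
... | no _ with suc k ∣? q
...   | yes 1+k∣q = contradiction 1+k∣q 1+k∤q
...   | no _      = refl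

-- Representative pairs in each case.

module Cases {q : ℕ} (F : FiniteFieldOn q) (θ : Fin q) (θ-primitive : FiniteFieldOn.IsPrimitive F θ)
             (k′ r : ℕ) .{{_ : ℕ.NonZero r}} (q≡1+kr : q ≡ suc (suc k′ ℕ.* r)) (1≤k′ : 1 ℕ.≤ k′) where
  open Field F
  open Polynomials F
  open ProjectiveLine F
  open Stabiliser F θ θ-primitive k′ r q≡1+kr
  open BaseBlock F θ θ-primitive k r q≡1+kr
  open Counting F θ θ-primitive k′ r q≡1+kr
  open ≡-Reasoning

  stab-⊙ : ∀ M N → Stab M → Stab N → Stab (M ⊙ N)
  stab-⊙ M N M-stab N-stab P = mk⇔
    (λ P∈ℬ → subst ℬ (sym (⊙-⟨$⟩ M N P)) (Equivalence.to (M-stab _) (Equivalence.to (N-stab P) P∈ℬ)))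
    (λ MNP∈ℬ → Equivalence.from (N-stab P) (Equivalence.from (M-stab _) (subst ℬ (⊙-⟨$⟩ M N P) MNP∈ℬ)))

  stab⇒preserves : ∀ M → Stab M → Preserves M
  stab⇒preserves M M-stab P = Equivalence.to (M-stab P)

  affine : ∀ a b → a ≢ 0# → PGL
  affine a b a≢0 = pgl a b 0# 1# (a≢0 ∘ trans (solve 2 (λ a b → a := a :* 1: :+ :- (b :* 0:)) refl a b))

  affine-suc : ∀ a b (a≢0 : a ≢ 0#) x → affine a b a≢0 ⟨$⟩ suc x ≡ suc (a * x + b)
  affine-suc a b a≢0 x = suc-⟨$⟩ (affine a b a≢0)
    (λ eq → 1≢0 (trans (solve 1 (λ x → 1: := 0: :* x :+ 1:) refl x) eq))
    (solve 3 (λ a b x → a :* x :+ b := (0: :* x :+ 1:) :* (a :* x :+ b)) refl a b x)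

  affine-∞ : ∀ a b (a≢0 : a ≢ 0#) → affine a b a≢0 ⟨$⟩ ∞ ≡ ∞
  affine-∞ a b a≢0 with 0# ≟ 0#
  ... | yes _   = refl
  ... | no  0≢0 = contradiction refl 0≢0

  affine-stab : ∀ a b (a≢0 : a ≢ 0#) → (∀ x → ℬ (suc x) ⇔ ℬ (suc (a * x + b))) → Stab (affine a b a≢0)
  affine-stab a b a≢0 stab ∞       = mk⇔ (λ ()) (subst ℬ (affine-∞ a b a≢0))
  affine-stab a b a≢0 stab (suc x) = mk⇔
    (λ p → subst ℬ (sym (affine-suc a b a≢0 x)) (Equivalence.to (stab x) p))
    (λ p → Equivalence.from (stab x) (subst ℬ (affine-suc a b a≢0 x) p))

  scaling : ∀ {u} → u ^ k ≡ 1# → PGL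
  scaling {u} u^k≡1 = affine u 0# (x^k≡1⇒x≢0 u^k≡1)

  scaling-suc : ∀ {u} (u^k≡1 : u ^ k ≡ 1#) x → scaling u^k≡1 ⟨$⟩ suc x ≡ suc (u * x)
  scaling-suc {u} u^k≡1 x = trans (affine-suc u 0# (x^k≡1⇒x≢0 u^k≡1) x) (cong suc (+-identityʳ _))

  scaling-stab : ∀ {u} (u^k≡1 : u ^ k ≡ 1#) → Stab (scaling u^k≡1)
  scaling-stab {u} u^k≡1 = affine-stab u 0# (x^k≡1⇒x≢0 u^k≡1) λ x → mk⇔
    (λ p → subst (ℬ ∘ suc) (sym (+-identityʳ _)) (ℬ-scale u^k≡1 p))
    (λ p → subst (ℬ ∘ suc) (begin
      u ⁻¹ * (u * x + 0#)   ≡⟨ solve 3 (λ u v x → v :* (u :* x :+ 0:) := u :* v :* x) refl u (u ⁻¹) x ⟩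
      u * u ⁻¹ * x          ≡⟨ cong (_* x) (inverse u (x^k≡1⇒x≢0 u^k≡1)) ⟩
      1# * x                ≡⟨ *-identityˡ x ⟩
      x                     ∎) (ℬ-scale (root-⁻¹ u^k≡1) p))

  scaling⁻¹-self : ∀ {u} (u^k≡1 : u ^ k ≡ 1#) → scaling (root-⁻¹ u^k≡1) ⟨$⟩ suc u ≡ 𝟙
  scaling⁻¹-self {u} u^k≡1 = trans (scaling-suc (root-⁻¹ u^k≡1) u) (cong suc (inverseˡ u (x^k≡1⇒x≢0 u^k≡1)))

  scaling-𝟘 : ∀ {u} (u^k≡1 : u ^ k ≡ 1#) → scaling u^k≡1 ⟨$⟩ 𝟘 ≡ 𝟘
  scaling-𝟘 {u} u^k≡1 = trans (scaling-suc u^k≡1 0#) (cong suc (zeroʳ u))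

  -- Fixing 0 leaves only multiplication by some u, and u is the image of 1.
  fixes-𝟘-𝟙⇒id : ∀ h → Stab h → h ⟨$⟩ 𝟘 ≡ 𝟘 → h ⟨$⟩ 𝟙 ≡ 𝟙 → ∀ i → h ⟨$⟩ β i ≡ β i
  fixes-𝟘-𝟙⇒id h h-stab h0 h1 i with fixes-𝟘⇒scaling 1≤k′ h (stab⇒preserves h h-stab) h0
  ... | u , h≡u = trans (h≡u (element i)) (cong suc (trans (cong (_* element i) u≡1) (*-identityˡ _)))
    where
    u≡1 : u ≡ 1#
    u≡1 = trans (sym (*-identityʳ u)) (Fin.suc-injective (trans (sym (h≡u 1#)) h1))

  𝟘≢𝟙 : 𝟘 ≢ 𝟙
  𝟘≢𝟙 eq = 0≢1 (Fin.suc-injective eq)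

  unit : 1# ^ k ≡ 1#
  unit = 1^n≡1 k

  module Transitive (h₀ : PGL) (h₀-stab : Stab h₀) (h₀1≡0 : h₀ ⟨$⟩ 𝟙 ≡ 𝟘) where

    to-𝟘 : ∀ P → ℬ P → ∃ λ h → Stab h × h ⟨$⟩ P ≡ 𝟘
    to-𝟘 (suc x) (inj₁ refl)  = scaling unit , scaling-stab unit , scaling-𝟘 unit
    to-𝟘 (suc x) (inj₂ x^k≡1) = h₀ ⊙ s , stab-⊙ h₀ s h₀-stab (scaling-stab (root-⁻¹ x^k≡1)) ,
      trans (⊙-⟨$⟩ h₀ s (suc x)) (trans (cong (h₀ ⟨$⟩_) (scaling⁻¹-self x^k≡1)) h₀1≡0)
      where s = scaling (root-⁻¹ x^k≡1)

    -- Once P is at 0, the image of Q is a root of unity, and a scaling takes it to 1 while fixing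
    -- 0.
    to-𝟘-𝟙 : ∀ P Q → P ≢ Q → ℬ P → ℬ Q → ∃ λ h → Stab h × (h ⟨$⟩ P ≡ 𝟘) × (h ⟨$⟩ Q ≡ 𝟙)
    to-𝟘-𝟙 P Q P≢Q P∈ℬ Q∈ℬ = from-𝟘 (to-𝟘 P P∈ℬ)
      where
      from-𝟘 : (∃ λ h → Stab h × h ⟨$⟩ P ≡ 𝟘) → ∃ λ h → Stab h × (h ⟨$⟩ P ≡ 𝟘) × (h ⟨$⟩ Q ≡ 𝟙)
      from-𝟘 (h , h-stab , hP≡0) = normalise _ refl (Equivalence.to (h-stab Q) Q∈ℬ)
        where
        normalise : ∀ R → h ⟨$⟩ Q ≡ R → ℬ R → ∃ λ h → Stab h × (h ⟨$⟩ P ≡ 𝟘) × (h ⟨$⟩ Q ≡ 𝟙)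
        normalise (suc y) hQ≡y (inj₁ refl)  = contradiction (⟨$⟩-injective h (trans hP≡0 (sym hQ≡y))) P≢Q
        normalise (suc y) hQ≡y (inj₂ y^k≡1) = s ⊙ h , stab-⊙ s h (scaling-stab (root-⁻¹ y^k≡1)) h-stab ,
          trans (⊙-⟨$⟩ s h P) (trans (cong (s ⟨$⟩_) hP≡0) (scaling-𝟘 (root-⁻¹ y^k≡1))) ,
          trans (⊙-⟨$⟩ s h Q) (trans (cong (s ⟨$⟩_) hQ≡y) (scaling⁻¹-self y^k≡1))
          where s = scaling (root-⁻¹ y^k≡1)

    transversal : PairTransversal 1
    transversal = record
      -- Index `zero` stands for 0 in B, and `suc zero` for ω⁰ = 1.
      { fst     = λ _ → zero
      ; snd     = λ _ → suc zero
      ; fst≢snd = λ _ ()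
      ; reach   = λ i₁ i₂ i₁≢i₂ → zero , to-𝟘-𝟙 (β i₁) (β i₂) (i₁≢i₂ ∘ β-injective) (β∈ℬ i₁) (β∈ℬ i₂)
      ; rigid   = λ { h h-stab zero zero h0 h1 → refl , fixes-𝟘-𝟙⇒id h h-stab h0 h1 }
      }

  module Rigid (𝟙↛𝟘 : ∀ h → Stab h → h ⟨$⟩ 𝟙 ≢ 𝟘) where

    -- If h sent a root of unity x to 0, then h after multiplication by x would send 1 to 0.
    fixes-𝟘 : ∀ h → Stab h → h ⟨$⟩ 𝟘 ≡ 𝟘
    fixes-𝟘 h h-stab = preimage (h ⁻ ⟨$⟩ 𝟘) (⁻-inverseʳ h 𝟘)
      (Equivalence.from (h-stab _) (subst ℬ (sym (⁻-inverseʳ h 𝟘)) (inj₁ refl)))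
      where
      preimage : ∀ P → h ⟨$⟩ P ≡ 𝟘 → ℬ P → h ⟨$⟩ 𝟘 ≡ 𝟘
      preimage (suc x) hx≡0 (inj₁ refl)  = hx≡0
      preimage (suc x) hx≡0 (inj₂ x^k≡1) = contradiction
        (trans (⊙-⟨$⟩ h s 𝟙) (trans (cong (h ⟨$⟩_) (trans (scaling-suc x^k≡1 1#) (cong suc (*-identityʳ x)))) hx≡0))
        (𝟙↛𝟘 (h ⊙ s) (stab-⊙ h s h-stab (scaling-stab x^k≡1)))
        where s = scaling x^k≡1

    one : Fin (suc k)
    one = suc zero

    one≢ : ∀ (i : Fin k) → one ≢ punchIn one i
    one≢ i eq = Fin.punchInᵢ≢i one i (sym eq)

    -- The k + 1 representatives are (0, 1) and (1, y) for the k elements y ≠ 1 of B: scalings bring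
    -- the second entry to 1 if the first is 0, and the first entry to 1 otherwise.
    fst snd : Fin (suc k) → Fin (suc k)
    fst zero    = zero
    fst (suc i) = one
    snd zero    = one
    snd (suc i) = punchIn one i

    reach : ∀ i₁ i₂ → i₁ ≢ i₂ → ∃ λ j → ∃ λ h → Stab h × (h ⟨$⟩ β i₁ ≡ β (fst j)) × (h ⟨$⟩ β i₂ ≡ β (snd j))
    reach zero    zero     0≢0   = contradiction refl 0≢0
    reach zero    (suc i₂) _     = zero , scaling (root-⁻¹ root) , scaling-stab (root-⁻¹ root) , scaling-𝟘 (root-⁻¹ root) , scaling⁻¹-self root
      where root = ω^i-root (toℕ i₂)
    reach (suc i₁) i₂      i₁≢i₂ = normalised (β-surjective _ (Equivalence.to (s-stab _) (β∈ℬ i₂)))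
      where
      root = ω^i-root (toℕ i₁)
      s = scaling (root-⁻¹ root)
      s-stab : Stab s
      s-stab = scaling-stab (root-⁻¹ root)
      normalised : (∃ λ l → β l ≡ s ⟨$⟩ β i₂) →
        ∃ λ j → ∃ λ h → Stab h × (h ⟨$⟩ β (suc i₁) ≡ β (fst j)) × (h ⟨$⟩ β i₂ ≡ β (snd j))
      normalised (l , βl≡) = suc (punchOut one≢l) , s , s-stab , scaling⁻¹-self root ,
        trans (sym βl≡) (cong β (sym (Fin.punchIn-punchOut one≢l)))
        where
        one≢l : one ≢ l
        one≢l refl = i₁≢i₂ (β-injective (⟨$⟩-injective s (trans (scaling⁻¹-self root) βl≡)))

    rigid : ∀ h → Stab h → ∀ j j′ → h ⟨$⟩ β (fst j) ≡ β (fst j′) → h ⟨$⟩ β (snd j) ≡ β (snd j′) →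
            j ≡ j′ × (∀ i → h ⟨$⟩ β i ≡ β i)
    rigid h h-stab zero    zero    h₁ h₂ = refl , fixes-𝟘-𝟙⇒id h h-stab h₁ h₂
    rigid h h-stab zero    (suc _) h₁ h₂ = contradiction (trans (sym (fixes-𝟘 h h-stab)) h₁) 𝟘≢𝟙
    rigid h h-stab (suc _) zero    h₁ h₂ = contradiction h₁ (𝟙↛𝟘 h h-stab)
    rigid h h-stab (suc i) (suc i′) h₁ h₂ =
      cong suc (Fin.punchIn-injective one i i′ (β-injective (trans (sym (h-id (punchIn one i))) h₂))) , h-id
      where
      h-id : ∀ i → h ⟨$⟩ β i ≡ β i
      h-id = fixes-𝟘-𝟙⇒id h h-stab (fixes-𝟘 h h-stab) h₁

    transversal : PairTransversal (suc k)
    transversal = record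
      { fst     = fst
      ; snd     = snd
      ; fst≢snd = λ { zero () ; (suc i) → one≢ i }
      ; reach   = reach
      ; rigid   = rigid
      }

  -- If 1 goes to 0, then 0 goes to a root of unity u; multiplying by u⁻¹ afterwards gives a map
  -- that exchanges 0 and 1.
  1+k∤q⇒𝟙↛𝟘 : 4 ℕ.≤ k → ¬ (suc k ∣ q) → ∀ h → Stab h → h ⟨$⟩ 𝟙 ≢ 𝟘
  1+k∤q⇒𝟙↛𝟘 4≤k 1+k∤q h h-stab h1≡0 = image-of-𝟘 _ refl (Equivalence.to (h-stab 𝟘) (inj₁ refl))
    where
    image-of-𝟘 : ∀ P → h ⟨$⟩ 𝟘 ≡ P → ℬ P → ⊥
    image-of-𝟘 (suc u) h0≡u (inj₁ refl)  = 𝟘≢𝟙 (⟨$⟩-injective h (trans h0≡u (sym h1≡0)))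
    image-of-𝟘 (suc u) h0≡u (inj₂ u^k≡1) = 1+k∤q (1-x-closed⇒1+k∣q 1≤k′ (swap⇒1-x 4≤k (s ⊙ h)
      (stab⇒preserves (s ⊙ h) (stab-⊙ s h (scaling-stab (root-⁻¹ u^k≡1)) h-stab))
      (trans (⊙-⟨$⟩ s h 𝟘) (trans (cong (s ⟨$⟩_) h0≡u) (scaling⁻¹-self u^k≡1)))
      (trans (⊙-⟨$⟩ s h 𝟙) (trans (cong (s ⟨$⟩_) h1≡0) (scaling-𝟘 (root-⁻¹ u^k≡1))))))
      where s = scaling (root-⁻¹ u^k≡1)

  module Subfield {p} m (p-prime : Prime p) (ιp≡0 : ι p ≡ 0#) (1+k≡p^m : suc k ≡ p ℕ.^ m) where

    frobenius-1+k : ∀ x → (1# + x) ^ suc k ≡ 1# + x ^ suc k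
    frobenius-1+k x = subst (λ n → (1# + x) ^ n ≡ 1# + x ^ n) (sym 1+k≡p^m) (frobenius-^ p-prime ιp≡0 m x)

    ℬ⇒fixed : ∀ x → ℬ (suc x) → x ^ suc k ≡ x
    ℬ⇒fixed x (inj₁ refl)  = zeroˡ _
    ℬ⇒fixed x (inj₂ x^k≡1) = trans (cong (x *_) x^k≡1) (*-identityʳ x)

    fixed⇒ℬ : ∀ x → x ^ suc k ≡ x → ℬ (suc x)
    fixed⇒ℬ x fixed with x ≟ 0#
    ... | yes x≡0 = inj₁ x≡0
    ... | no  x≢0 = inj₂ (*-cancelˡ x≢0 (trans fixed (sym (*-identityʳ x))))

    -- Reads y = x - 1 as x = 1 + y, the shape in which `frobenius-1+k` applies.
    translate : ∀ x → 1# + (1# * x + - 1#) ≡ x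
    translate = solve 1 (λ x → 1: :+ (1: :* x :+ :- 1:) := x) refl

    stab : ∀ x → ℬ (suc x) ⇔ ℬ (suc (1# * x + - 1#))
    stab x = mk⇔
      (λ p → fixed⇒ℬ y (+-cancel (trans (sym (frobenius-1+k y)) (trans (cong (_^ suc k) (translate x)) (trans (ℬ⇒fixed x p) (sym (translate x)))))))
      (λ p → fixed⇒ℬ x (begin
        x ^ suc k           ≡⟨ cong (_^ suc k) (translate x) ⟨
        (1# + y) ^ suc k    ≡⟨ frobenius-1+k y ⟩
        1# + y ^ suc k      ≡⟨ cong (1# +_) (ℬ⇒fixed y p) ⟩
        1# + y              ≡⟨ translate x ⟩
        x                   ∎))
      where
      y = 1# * x + - 1#
      +-cancel : ∀ {a b} → 1# + a ≡ 1# + b → a ≡ b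
      +-cancel {a} {b} eq = x-y≡0⇒x≡y (trans (solve 2 (λ a b → a :+ :- b := 1: :+ a :+ :- (1: :+ b)) refl a b) (x≡y⇒x-y≡0 eq))

    transversal : PairTransversal 1
    transversal = Transitive.transversal (affine 1# (- 1#) 1≢0) (affine-stab 1# (- 1#) 1≢0 stab)
      (trans (affine-suc 1# (- 1#) 1≢0 1#) (cong suc (solve 0 (1: :* 1: :+ :- 1: := 0:) refl)))

  -- For k = 3 the involution x ↦ (1 − x)/(1 + 2x) swaps 0 with 1 and the other two cube roots of unity.
  module Tetrahedral (k≡3 : k ≡ 3) where

    3≢0 : 1# + 1# + 1# ≢ 0#
    3≢0 = subst (λ n → ι n ≢ 0#) k≡3 ιk≢0

    -- The coefficient 2 solves (k - 1)(c - 1) = 2 for k = 3. The determinant is -3, which is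
    -- nonzero because k is.
    h₀ : PGL
    h₀ = pgl (- 1#) 1# (1# + 1#) 1# λ eq → 3≢0 (begin
      1# + 1# + 1#                                ≡⟨ solve 0 (1: :+ 1: :+ 1: := :- (:- 1: :* 1: :+ :- (1: :* (1: :+ 1:)))) refl ⟩
      - (- 1# * 1# + - (1# * (1# + 1#)))          ≡⟨ cong -_ eq ⟩
      - 0#                                        ≡⟨ solve 0 (:- 0: := 0:) refl ⟩
      0#                                          ∎)

    -- The matrix has trace 0 and determinant -3, so its square is the scalar 3.
    involutive : ∀ P → h₀ ⟨$⟩ h₀ ⟨$⟩ P ≡ P
    involutive P = coords-unique (⟨$⟩-coords h₀ (⟨$⟩-coords h₀ (coords P))) (coords-≡
      (solve 2 (λ n m → (1: :+ 1: :+ 1:) :* n := :- 1: :* (:- 1: :* n :+ 1: :* m) :+ 1: :* ((1: :+ 1:) :* n :+ 1: :* m)) refl (num P) (den P))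
      (solve 2 (λ n m → (1: :+ 1: :+ 1:) :* m := (1: :+ 1:) :* (:- 1: :* n :+ 1: :* m) :+ 1: :* ((1: :+ 1:) :* n :+ 1: :* m)) refl (num P) (den P))
      (coords-scale (1# + 1# + 1#) 3≢0 (coords P)))

    h₀𝟘 : h₀ ⟨$⟩ 𝟘 ≡ 𝟙
    h₀𝟘 = suc-⟨$⟩ h₀ (λ eq → 1≢0 (trans (solve 0 (1: := (1: :+ 1:) :* 0: :+ 1:) refl) eq))
      (solve 0 (:- 1: :* 0: :+ 1: := ((1: :+ 1:) :* 0: :+ 1:) :* 1:) refl)

    h₀𝟙 : h₀ ⟨$⟩ 𝟙 ≡ 𝟘
    h₀𝟙 = trans (cong (h₀ ⟨$⟩_) (sym h₀𝟘)) (involutive 𝟘)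

    cube : ∀ {x} → x ^ k ≡ 1# → x * (x * (x * 1#)) ≡ 1#
    cube {x} = subst (λ n → x ^ n ≡ 1#) k≡3

    -- From 1 + x + x² = 0 and x³ = 1 follows (2x + 1) x² = 2 + x² = 1 - x. The denominator is
    -- nonzero because (2x + 1)² = 4 (1 + x + x²) - 3 = -3.
    nontrivial-root : ∀ x → x ^ k ≡ 1# → x ≢ 1# → h₀ ⟨$⟩ suc x ≡ suc (x * x)
    nontrivial-root x x^k≡1 x≢1 = suc-⟨$⟩ h₀ 2x+1≢0 (x-y≡0⇒x≡y (combine₂ (- (1# + 1#)) (- 1#) (cube x^k≡1) 1+x+x²≡0
      (solve 1 (λ x → :- 1: :* x :+ 1: :+ :- (((1: :+ 1:) :* x :+ 1:) :* (x :* x))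
        := :- (1: :+ 1:) :* (x :* (x :* (x :* 1:)) :+ :- 1:) :+ :- 1: :* (1: :+ x :+ x :* x :+ :- 0:)) refl x)))
      where
      open BinomialEquations F
      1+x+x²≡0 : 1# + x + x * x ≡ 0#
      1+x+x²≡0 = xy≡0⇒y≡0 (λ eq → x≢1 (x-y≡0⇒x≡y eq)) (combine₁ 1# (cube x^k≡1)
        (solve 1 (λ x → (x :+ :- 1:) :* (1: :+ x :+ x :* x) := 1: :* (x :* (x :* (x :* 1:)) :+ :- 1:)) refl x))
      2x+1≢0 : (1# + 1#) * x + 1# ≢ 0#
      2x+1≢0 eq = 3≢0 (combine₂ (1# + 1# + 1# + 1#) (- ((1# + 1#) * x + 1#)) 1+x+x²≡0 eq
        (solve 1 (λ x → 1: :+ 1: :+ 1: := (1: :+ 1: :+ 1: :+ 1:) :* (1: :+ x :+ x :* x :+ :- 0:) :+ :- ((1: :+ 1:) :* x :+ 1:) :* ((1: :+ 1:) :* x :+ 1: :+ :- 0:)) refl x))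

    h₀-preserves : Preserves h₀
    h₀-preserves (suc x) (inj₁ refl) = subst ℬ (sym h₀𝟘) (inj₂ unit)
    h₀-preserves (suc x) (inj₂ x^k≡1) with x ≟ 1#
    ... | yes refl = subst ℬ (sym h₀𝟙) (inj₁ refl)
    ... | no  x≢1  = subst ℬ (sym (nontrivial-root x x^k≡1 x≢1)) (inj₂ (root-* x^k≡1 x^k≡1))

    transversal : PairTransversal 1
    transversal = Transitive.transversal h₀
      (λ P → mk⇔ (h₀-preserves P) (λ p → subst ℬ (involutive P) (h₀-preserves _ p))) h₀𝟙

  design : ∀ {m n} → PairTransversal m → m ℕ.* k′ ≡ n → ∀ (T : Subset (suc q)) → ∣ T ∣ ≡ 3 →
    ∃ λ (L : List (Subset (suc q))) → (length L ≡ n) × Unique L × (∀ S → (S ∈L L) ⇔ (IsBlock θ r S × T ⊆ S))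
  design transversal refl T ∣T∣≡3 = blocks-through transversal (∣T∣≡3⇒three T ∣T∣≡3)

-- Assembly of the cases.

open import Data.Nat using (_≥_; _^_; _*_; _∸_)

theorem4 : (p n q : ℕ) → Prime p → q ≡ p ^ n →
  (F : FiniteFieldOn q) → (θ : Fin q) → FiniteFieldOn.IsPrimitive F θ →
  (k r : ℕ) → k ≥ 3 → r ≥ 1 → q ∸ 1 ≡ k * r →
  -- every block (element of the PGL(2,q)-orbit of B) is a (k+1)-subset of X
  (∀ (S : Subset (suc q)) → FiniteFieldOn.IsBlock F θ r S → ∣ S ∣ ≡ suc k) ×
  -- every 3-subset of X lies in exactly λ distinct blocks
  (∀ (T : Subset (suc q)) → ∣ T ∣ ≡ 3 →
    ∃ λ (L : List (Subset (suc q))) →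
      (length L ≡ lam q k) × Unique L ×
      (∀ S → (S ∈L L) ⇔ (FiniteFieldOn.IsBlock F θ r S × T ⊆ S)))
theorem4 p n zero _ _ F _ _ _ _ _ _ _ = ⊥-elim (Fin.¬Fin0 (FiniteFieldOn.0# F))
theorem4 p n q@(suc q′) p-prime q≡p^n F θ θ-primitive k@(suc k′) r k≥3 r≥1 q′≡kr =
  Counting.block-card F θ θ-primitive k′ r q≡1+kr , blocks (k ℕ.≟ 3) (suc k ∣? q)
  where
  instance _ = ℕ.>-nonZero r≥1
  q≡1+kr : q ≡ suc (k * r)
  q≡1+kr = cong suc q′≡kr
  open Cases F θ θ-primitive k′ r q≡1+kr (ℕ.≤-trans (ℕ.s≤s ℕ.z≤n) (ℕ.s≤s⁻¹ k≥3))
  Blocks : Set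
  Blocks = ∀ (T : Subset (suc q)) → ∣ T ∣ ≡ 3 →
    ∃ λ (L : List (Subset (suc q))) → (length L ≡ lam q k) × Unique L ×
      (∀ S → (S ∈L L) ⇔ (FiniteFieldOn.IsBlock F θ r S × T ⊆ S))
  blocks : Dec (k ≡ 3) → Dec (suc k ∣ q) → Blocks
  blocks (yes k≡3) _ = design (Tetrahedral.transversal k≡3)
    -- `lam q 3` computes to 2, which is k′ for k = 3.
    (trans (ℕ.*-identityˡ k′) (trans (cong ℕ.pred k≡3) (cong (lam q) (sym k≡3))))
  blocks (no k≢3) (yes 1+k∣q) = design
    (Subfield.transversal (proj₁ power) p-prime (Polynomials.q≡p^n⇒ιp≡0 F n q≡p^n)
      (proj₂ power))
    (trans (ℕ.*-identityˡ k′) (sym (lam-∣ q k k≢3 1+k∣q)))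
    where power = ∣-prime-power p-prime n (subst (suc k ∣_) q≡p^n 1+k∣q)
  blocks (no k≢3) (no 1+k∤q) = design
    (Rigid.transversal (1+k∤q⇒𝟙↛𝟘 (ℕ.≤∧≢⇒< k≥3 (k≢3 ∘ sym)) 1+k∤q))
    (sym (lam-∤ q k k≢3 1+k∤q))
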